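{- Let $p$ be a prime number, let $K$ be a field with embeddings into $\mathbb{R}$ and $\mathbb{Q}_p$, and let $\alpha\in K$. For $n\ge 0$ let $p_n/q_n$ be the $n$-th convergent of $\alpha$ obtained from the algorithm described in the context. Then, in $\mathbb{Q}_p$, $$\lim_{n\to\infty}\frac{p_n}{q_n}=\alpha_{\langle p\rangle}.$$
   Context: Let $p$ be a prime and $K$ a field with field embeddings $\sigma_\infty:K\to\mathbb{R}$ and $\sigma_p:K\to\mathbb{Q}_p$. For $\alpha\in K$ write $\alpha_\infty=\sigma_\infty(\alpha)$, $\alpha_{\langle p\rangle}=\sigma_p(\alpha)$. For $u=\sum_{n}c_np^n\in\mathbb{Q}_p$ with digits $c_n\in\{0,\dots,p-1\}$ ($c_n=0$ for $n<v_p(u)$), put $\lfloor u\rfloor_p=\sum_{n\le 0}c_np^n\in\mathbb{Z}[1/p]$. For $\alpha\in K$ let $b^{(0)}(\alpha)=mp+\lfloor\alpha_{\langle p\rangle}\rfloor_p$, where $m$ is the smallest among the integers $i$ minimizing $|\alpha_\infty-ip-\lfloor\alpha_{\langle p\rangle}\rfloor_p|$; let $b^{(1)}(\alpha)=m'+\lfloor\alpha_{\langle p\rangle}\rfloor_p$, where $m'$ is the smallest among the integers $i$ minimizing $|\alpha_\infty-i-\lfloor\alpha_{\langle p\rangle}\rfloor_p|$. For $\epsilon\in\{0,1\}$ let $F_{p,\epsilon}(\alpha)=\frac{1}{\alpha-b^{(\epsilon)}(\alpha)}$, undefined if $\alpha=b^{(\epsilon)}(\alpha)$. Algorithm: $\alpha_0=\alpha$;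 for $n\ge0$ put $\epsilon=0$ if $n$ is even and $\epsilon=1$ if $n$ is odd, $b_n(\alpha)=b^{(\epsilon)}(\alpha_n)$ and $\alpha_{n+1}=F_{p,\epsilon}(\alpha_n)$; the algorithm halts if $F_{p,\epsilon}(\alpha_n)$ is undefined. Convergents: $p_{ -1}=1$, $q_{ -1}=0$ and, for $n\ge0$ (as long as $b_n(\alpha)$ is defined), $$\begin{pmatrix} p_n & p_{n-1} \\ q_n & q_{n-1} \end{pmatrix}=\begin{pmatrix} b_0(\alpha) & 1 \\ 1 & 0 \end{pmatrix}\cdots\begin{pmatrix} b_n(\alpha) & 1 \\ 1 & 0 \end{pmatrix}.$$ One has $q_n\neq0$ for all such $n\ge0$. If the algorithm halts, so that there are only finitely many convergents $p_0/q_0,\dots,p_N/q_N$, the limit is understood as the last convergent $p_N/q_N$. -}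

module Defs where

open import Level using (Level; 0ℓ; _⊔_)
open import Algebra.Bundles using (RawRing; CommutativeRing)
open import Algebra.Apartness.Bundles using (HeytingField; HeytingCommutativeRing)
open import Algebra.Morphism.Structures using (module RingMorphisms)
import Algebra.Definitions.RawMonoid as RawMonoidDefinitions
open import Data.Empty using (⊥-elim)
open import Data.Fin.Base using (Fin; zero; suc; toℕ)
open import Data.Integer.Base as ℤ using (ℤ; +_; -[1+_]; +[1+_])
import Data.Integer.Properties as ℤₚ
import Data.Integer.Divisibility.Signed as ℤ∣
open import Data.Nat.Base as ℕ using (ℕ; zero; suc; _^_)
import Data.Nat.Properties as ℕₚ
open import Data.Nat.Divisibility as ℕ∣ using (_∣_; _∣?_; divides)
open import Data.Nat.DivMod using (_mod_)
open import Data.Nat.Primality using (Prime; prime⇒nonZero; prime⇒nonTrivial; euclidsLemma)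
open import Data.Product.Base using (∃-syntax; Σ-syntax; _×_; _,_)
open import Data.Rational.Base as ℚ
  using (ℚ; mkℚ; 0ℚ; 1ℚ; ½; _+_; _*_; _-_; -_; _/_; _÷_; 1/_; _≤_; _<_; ↥_; ↧_; ↧ₙ_; toℚᵘ; Positive)
import Data.Rational.Properties as ℚₚ
open import Data.Rational.Solver using (module +-*-Solver)
open import Data.Rational.Unnormalised.Base as ℚᵘ using (ℚᵘ; mkℚᵘ; *≡*; *≤*)
import Data.Rational.Unnormalised.Properties as ℚᵘₚ
open import Data.Sum.Base using (_⊎_; inj₁; inj₂; map)
open import Relation.Binary.PropositionalEquality
  using (_≡_; _≢_; refl; sym; trans; cong; cong₂; subst; subst₂; module ≡-Reasoning)
open import Relation.Nullary using (¬_; yes; no)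

-- ∥-x∥≡∥x∥ follows from the other laws; it is a field for convenience.
record AbsoluteValue : Set where
  field
    ∥_∥       : ℚ → ℚ
    0≤∥x∥     : ∀ x → 0ℚ ≤ ∥ x ∥
    ∥0∥≡0     : ∥ 0ℚ ∥ ≡ 0ℚ
    ∥x∥≡0⇒x≡0 : ∀ x → ∥ x ∥ ≡ 0ℚ → x ≡ 0ℚ
    ∥x*y∥     : ∀ x y → ∥ x * y ∥ ≡ ∥ x ∥ * ∥ y ∥
    ∥x+y∥     : ∀ x y → ∥ x + y ∥ ≤ ∥ x ∥ + ∥ y ∥
    ∥-x∥≡∥x∥  : ∀ x → ∥ - x ∥ ≡ ∥ x ∥

private
  halves : ∀ ε → ½ * ε + ½ * ε ≡ ε
  halves = solve 1 (λ e → con ½ :* e :+ con ½ :* e := e) refl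
    where open +-*-Solver

  half-pos : ∀ {ε} → 0ℚ < ε → 0ℚ < ½ * ε
  half-pos {ε} 0<ε = subst (_< ½ * ε) (ℚₚ.*-zeroʳ ½) (ℚₚ.*-monoʳ-<-pos ½ 0<ε)

  small : ∀ {ε A} → 0ℚ < ε → 0ℚ < A → ∃[ δ ] 0ℚ < δ × A * δ ≡ ½ * ε
  small {ε} {A} 0<ε 0<A = (½ * ε) * 1/A , 0<δ , eq
    where
    instance
      A-pos : Positive A
      A-pos = ℚ.positive 0<A
      A≢0 : ℚ.NonZero A
      A≢0 = ℚₚ.pos⇒nonZero A
    1/A : ℚ
    1/A = 1/ A
    instance
      1/A-pos : Positive 1/A
      1/A-pos = ℚₚ.1/pos⇒pos A
    0<δ : 0ℚ < (½ * ε) * 1/A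
    0<δ = subst (_< (½ * ε) * 1/A) (ℚₚ.*-zeroˡ 1/A) (ℚₚ.*-monoˡ-<-pos 1/A (half-pos 0<ε))
    eq : A * ((½ * ε) * 1/A) ≡ ½ * ε
    eq = begin
      A * ((½ * ε) * 1/A)  ≡⟨ shuffle A (½ * ε) 1/A ⟩
      (½ * ε) * (A * 1/A)  ≡⟨ cong ((½ * ε) *_) (ℚₚ.*-inverseʳ A) ⟩
      (½ * ε) * 1ℚ         ≡⟨ ℚₚ.*-identityʳ (½ * ε) ⟩
      ½ * ε                ∎
      where
      open ≡-Reasoning
      shuffle : ∀ a b c → a * (b * c) ≡ b * (a * c)
      shuffle = solve 3 (λ a b c → a :* (b :* c) := b :* (a :* c)) refl
        where open +-*-Solver

-- The completion of ℚ at an absolute value: Cauchy sequences of rationals,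
-- identified when their difference tends to 0.
module Completion (A : AbsoluteValue) where
  open AbsoluteValue A

  IsCauchy : (ℕ → ℚ) → Set
  IsCauchy x = ∀ ε → 0ℚ < ε → ∃[ N ] ∀ m n → N ℕ.≤ m → N ℕ.≤ n → ∥ x m - x n ∥ < ε

  record Carrier : Set where
    constructor ⟨_,_⟩
    field
      term   : ℕ → ℚ
      cauchy : IsCauchy term
  open Carrier public

  infix 4 _≈_
  _≈_ : Carrier → Carrier → Set
  x ≈ y = ∀ ε → 0ℚ < ε → ∃[ N ] ∀ n → N ℕ.≤ n → ∥ term x n - term y n ∥ < ε

  private
    bounded : ∀ x → IsCauchy x → ∃[ B ] ∃[ N ] 0ℚ < B × (∀ n → N ℕ.≤ n → ∥ x n ∥ ≤ B)
    bounded x cx with cx 1ℚ (ℚₚ.positive⁻¹ 1ℚ)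
    ... | N , close = ∥ x N ∥ + 1ℚ , N , pos , bd
      where
      pos : 0ℚ < ∥ x N ∥ + 1ℚ
      pos = subst (_< ∥ x N ∥ + 1ℚ) (ℚₚ.+-identityʳ 0ℚ) (ℚₚ.+-mono-≤-< (0≤∥x∥ (x N)) (ℚₚ.positive⁻¹ 1ℚ))
      split : ∀ a b → a ≡ b + (a - b)
      split = solve 2 (λ a b → a := b :+ (a :- b)) refl
        where open +-*-Solver
      bd : ∀ n → N ℕ.≤ n → ∥ x n ∥ ≤ ∥ x N ∥ + 1ℚ
      bd n N≤n = begin
        ∥ x n ∥                    ≡⟨ cong ∥_∥ (split (x n) (x N)) ⟩
        ∥ x N + (x n - x N) ∥      ≤⟨ ∥x+y∥ (x N) (x n - x N) ⟩
        ∥ x N ∥ + ∥ x n - x N ∥    ≤⟨ ℚₚ.+-monoʳ-≤ ∥ x N ∥ (ℚₚ.<⇒≤ (close n N N≤n ℕₚ.≤-refl)) ⟩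
        ∥ x N ∥ + 1ℚ               ∎
        where open ℚₚ.≤-Reasoning

    +-cauchy : ∀ x y → IsCauchy x → IsCauchy y → IsCauchy (λ n → x n + y n)
    +-cauchy x y cx cy ε 0<ε with cx (½ * ε) (half-pos 0<ε) | cy (½ * ε) (half-pos 0<ε)
    ... | M , p | N , q = M ℕ.⊔ N , λ m n hm hn → begin-strict
        ∥ (x m + y m) - (x n + y n) ∥        ≡⟨ cong ∥_∥ (regroup (x m) (y m) (x n) (y n)) ⟩
        ∥ (x m - x n) + (y m - y n) ∥        ≤⟨ ∥x+y∥ (x m - x n) (y m - y n) ⟩
        ∥ x m - x n ∥ + ∥ y m - y n ∥        <⟨ ℚₚ.+-mono-<
             (p m n (ℕₚ.≤-trans (ℕₚ.m≤m⊔n M N) hm) (ℕₚ.≤-trans (ℕₚ.m≤m⊔n M N) hn))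
             (q m n (ℕₚ.≤-trans (ℕₚ.m≤n⊔m M N) hm) (ℕₚ.≤-trans (ℕₚ.m≤n⊔m M N) hn)) ⟩
        ½ * ε + ½ * ε                        ≡⟨ halves ε ⟩
        ε                                    ∎
      where
      open ℚₚ.≤-Reasoning
      regroup : ∀ a b c d → (a + b) - (c + d) ≡ (a - c) + (b - d)
      regroup = solve 4 (λ a b c d → (a :+ b) :- (c :+ d) := (a :- c) :+ (b :- d)) refl
        where open +-*-Solver

    neg-cauchy : ∀ x → IsCauchy x → IsCauchy (λ n → - x n)
    neg-cauchy x cx ε 0<ε with cx ε 0<ε
    ... | N , p = N , λ m n hm hn → begin-strict
        ∥ (- x m) - (- x n) ∥   ≡⟨ cong ∥_∥ (regroup (x m) (x n)) ⟩
        ∥ - (x m - x n) ∥       ≡⟨ ∥-x∥≡∥x∥ (x m - x n) ⟩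
        ∥ x m - x n ∥           <⟨ p m n hm hn ⟩
        ε                       ∎
      where
      open ℚₚ.≤-Reasoning
      regroup : ∀ a b → (- a) - (- b) ≡ - (a - b)
      regroup = solve 2 (λ a b → (:- a) :- (:- b) := :- (a :- b)) refl
        where open +-*-Solver

    *-bound : ∀ {a b B δ} → 0ℚ < B → ∥ a ∥ ≤ B → ∥ b ∥ < δ → ∥ a * b ∥ < B * δ
    *-bound {a} {b} {B} {δ} 0<B a≤B b<δ = subst (_< B * δ) (sym (∥x*y∥ a b)) (ℚₚ.≤-<-trans
      (ℚₚ.*-monoʳ-≤-nonNeg ∥ b ∥ {{ℚ.nonNegative (0≤∥x∥ b)}} a≤B)
      (ℚₚ.*-monoʳ-<-pos B {{ℚ.positive 0<B}} b<δ))

    *-regroup : ∀ a b c d → a * b - c * d ≡ a * (b - d) + d * (a - c)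
    *-regroup = solve 4 (λ a b c d → a :* b :- c :* d := a :* (b :- d) :+ d :* (a :- c)) refl
      where open +-*-Solver

    *-close : ∀ {ε B C δ η} a b c d → 0ℚ < B → 0ℚ < C → B * δ ≡ ½ * ε → C * η ≡ ½ * ε →
              ∥ a ∥ ≤ B → ∥ d ∥ ≤ C → ∥ b - d ∥ < δ → ∥ a - c ∥ < η → ∥ a * b - c * d ∥ < ε
    *-close {ε} {B} {C} {δ} {η} a b c d 0<B 0<C Bδ Cη a≤B d≤C bd ac = begin-strict
      ∥ a * b - c * d ∥                      ≡⟨ cong ∥_∥ (*-regroup a b c d) ⟩
      ∥ a * (b - d) + d * (a - c) ∥          ≤⟨ ∥x+y∥ (a * (b - d)) (d * (a - c)) ⟩
      ∥ a * (b - d) ∥ + ∥ d * (a - c) ∥      <⟨ ℚₚ.+-mono-<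
        (*-bound {a} {b - d} 0<B a≤B bd) (*-bound {d} {a - c} 0<C d≤C ac) ⟩
      B * δ + C * η                          ≡⟨ cong₂ _+_ Bδ Cη ⟩
      ½ * ε + ½ * ε                          ≡⟨ halves ε ⟩
      ε                                      ∎
      where open ℚₚ.≤-Reasoning

    *-cauchy : ∀ x y → IsCauchy x → IsCauchy y → IsCauchy (λ n → x n * y n)
    *-cauchy x y cx cy ε 0<ε =
      let (B , M₁ , 0<B , hB) = bounded x cx
          (C , M₂ , 0<C , hC) = bounded y cy
          (δ , 0<δ , Bδ) = small 0<ε 0<B
          (η , 0<η , Cη) = small 0<ε 0<C
          (M₃ , p) = cy δ 0<δ
          (M₄ , q) = cx η 0<η
      in combine 0<B 0<C Bδ Cη M₁ M₂ M₃ M₄ hB hC p q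
      where
      combine : ∀ {B C δ η} → 0ℚ < B → 0ℚ < C → B * δ ≡ ½ * ε → C * η ≡ ½ * ε →
                ∀ M₁ M₂ M₃ M₄ →
                (∀ n → M₁ ℕ.≤ n → ∥ x n ∥ ≤ B) → (∀ n → M₂ ℕ.≤ n → ∥ y n ∥ ≤ C) →
                (∀ m n → M₃ ℕ.≤ m → M₃ ℕ.≤ n → ∥ y m - y n ∥ < δ) →
                (∀ m n → M₄ ℕ.≤ m → M₄ ℕ.≤ n → ∥ x m - x n ∥ < η) →
                ∃[ N ] ∀ m n → N ℕ.≤ m → N ℕ.≤ n → ∥ x m * y m - x n * y n ∥ < ε
      combine 0<B 0<C Bδ Cη M₁ M₂ M₃ M₄ hB hC p q = (M₁ ℕ.⊔ M₂) ℕ.⊔ (M₃ ℕ.⊔ M₄) , λ m n hm hn →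
        *-close (x m) (y m) (x n) (y n) 0<B 0<C Bδ Cη
          (hB m (ℕₚ.m⊔n≤o⇒m≤o M₁ M₂ (left hm))) (hC n (ℕₚ.m⊔n≤o⇒n≤o M₁ M₂ (left hn)))
          (p m n (ℕₚ.m⊔n≤o⇒m≤o M₃ M₄ (right hm)) (ℕₚ.m⊔n≤o⇒m≤o M₃ M₄ (right hn)))
          (q m n (ℕₚ.m⊔n≤o⇒n≤o M₃ M₄ (right hm)) (ℕₚ.m⊔n≤o⇒n≤o M₃ M₄ (right hn)))
        where
        left : ∀ {k} → (M₁ ℕ.⊔ M₂) ℕ.⊔ (M₃ ℕ.⊔ M₄) ℕ.≤ k → M₁ ℕ.⊔ M₂ ℕ.≤ k
        left = ℕₚ.m⊔n≤o⇒m≤o (M₁ ℕ.⊔ M₂) (M₃ ℕ.⊔ M₄)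
        right : ∀ {k} → (M₁ ℕ.⊔ M₂) ℕ.⊔ (M₃ ℕ.⊔ M₄) ℕ.≤ k → M₃ ℕ.⊔ M₄ ℕ.≤ k
        right = ℕₚ.m⊔n≤o⇒n≤o (M₁ ℕ.⊔ M₂) (M₃ ℕ.⊔ M₄)

  const : ℚ → Carrier
  const q = ⟨ (λ _ → q) , (λ ε 0<ε → 0 , λ _ _ _ _ →
    subst (_< ε) (sym (trans (cong ∥_∥ (ℚₚ.+-inverseʳ q)) ∥0∥≡0)) 0<ε) ⟩

  infixl 6 _⊕_ _⊖_
  infixl 7 _⊗_
  infix  8 ⊝_

  _⊕_ _⊗_ _⊖_ : Carrier → Carrier → Carrier
  x ⊕ y = ⟨ (λ n → term x n + term y n) , +-cauchy (term x) (term y) (cauchy x) (cauchy y) ⟩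
  x ⊗ y = ⟨ (λ n → term x n * term y n) , *-cauchy (term x) (term y) (cauchy x) (cauchy y) ⟩

  ⊝_ : Carrier → Carrier
  ⊝ x = ⟨ (λ n → - term x n) , neg-cauchy (term x) (cauchy x) ⟩

  x ⊖ y = x ⊕ (⊝ y)

  rawRing : RawRing 0ℓ 0ℓ
  rawRing = record
    { Carrier = Carrier ; _≈_ = _≈_ ; _+_ = _⊕_ ; _*_ = _⊗_ ; -_ = ⊝_
    ; 0# = const 0ℚ ; 1# = const 1ℚ }

usual : AbsoluteValue
usual = record
  { ∥_∥       = ℚ.∣_∣
  ; 0≤∥x∥     = ℚₚ.0≤∣p∣
  ; ∥0∥≡0     = refl
  ; ∥x∥≡0⇒x≡0 = ℚₚ.∣p∣≡0⇒p≡0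
  ; ∥x*y∥     = ℚₚ.∣p*q∣≡∣p∣*∣q∣
  ; ∥x+y∥     = ℚₚ.∣p+q∣≤∣p∣+∣q∣
  ; ∥-x∥≡∥x∥  = ℚₚ.∣-p∣≡∣p∣
  }

module Real = Completion usual

ℝ : Set
ℝ = Real.Carrier

infix 4 _≤ℝ_
_≤ℝ_ : ℝ → ℝ → Set
x ≤ℝ y = ∀ ε → 0ℚ < ε → ∃[ N ] ∀ n → N ℕ.≤ n → Real.term x n ≤ Real.term y n + ε

module Norm (A : AbsoluteValue) where
  open AbsoluteValue A
  open Completion A

  private
    ∣a∣<ε : ∀ {a ε} → a < ε → - a < ε → ℚ.∣ a ∣ < ε
    ∣a∣<ε {a} {ε} h k with ℚₚ.∣p∣≡p∨∣p∣≡-p a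
    ... | inj₁ e = subst (_< ε) (sym e) h
    ... | inj₂ e = subst (_< ε) (sym e) k

    one-side : ∀ x y → ∥ x ∥ - ∥ y ∥ ≤ ∥ x - y ∥
    one-side x y = begin
      ∥ x ∥ - ∥ y ∥                   ≡⟨ cong (λ z → ∥ z ∥ - ∥ y ∥) (split x y) ⟩
      ∥ (x - y) + y ∥ - ∥ y ∥         ≤⟨ ℚₚ.+-monoˡ-≤ (- ∥ y ∥) (∥x+y∥ (x - y) y) ⟩
      (∥ x - y ∥ + ∥ y ∥) - ∥ y ∥     ≡⟨ cancel ∥ x - y ∥ ∥ y ∥ ⟩
      ∥ x - y ∥                       ∎
      where
      open ℚₚ.≤-Reasoning
      open +-*-Solver
      split : ∀ a b → a ≡ (a - b) + b
      split = solve 2 (λ a b → a := (a :- b) :+ b) refl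
      cancel : ∀ a b → (a + b) - b ≡ a
      cancel = solve 2 (λ a b → (a :+ b) :- b := a) refl

    flip-neg : ∀ a b → - (a - b) ≡ b - a
    flip-neg = solve 2 (λ a b → :- (a :- b) := b :- a) refl
      where open +-*-Solver

    norm-cauchy : ∀ x → IsCauchy x → Real.IsCauchy (λ n → ∥ x n ∥)
    norm-cauchy x cx ε 0<ε with cx ε 0<ε
    ... | N , p = N , λ m n hm hn → ∣a∣<ε
      (ℚₚ.≤-<-trans (one-side (x m) (x n)) (p m n hm hn))
      (subst (_< ε) (sym (flip-neg ∥ x m ∥ ∥ x n ∥))
        (ℚₚ.≤-<-trans (one-side (x n) (x m)) (p n m hn hm)))

  norm : Carrier → ℝ
  norm x = Real.⟨ (λ n → ∥ term x n ∥) , norm-cauchy (term x) (cauchy x) ⟩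

  Tendsto : (ℕ → Carrier) → Carrier → Set
  Tendsto u ℓ = ∀ ε → 0ℚ < ε → ∃[ N ] ∀ n → N ℕ.≤ n → norm (u n ⊖ ℓ) ≤ℝ Real.const ε

∣_∣ℝ : ℝ → ℝ
∣_∣ℝ = Norm.norm usual

private
  frac-cong : ∀ a b c d .{{_ : ℕ.NonZero b}} .{{_ : ℕ.NonZero d}} →
              a ℕ.* d ≡ c ℕ.* b → + a / b ≡ + c / d
  frac-cong a b@(suc _) c d@(suc _) e = ℚₚ.fromℚᵘ-cong {mkℚᵘ (+ a) _} {mkℚᵘ (+ c) _}
    (*≡* (trans (sym (ℤₚ.pos-* a d)) (trans (cong +_ e) (ℤₚ.pos-* c b))))

  frac-mono : ∀ a b c d .{{_ : ℕ.NonZero b}} .{{_ : ℕ.NonZero d}} →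
              a ℕ.* d ℕ.≤ c ℕ.* b → + a / b ≤ + c / d
  frac-mono a b@(suc b-1) c d@(suc d-1) h = ℚₚ.toℚᵘ-cancel-≤
    (ℚᵘₚ.≤-respˡ-≃ (ℚᵘₚ.≃-sym (ℚₚ.toℚᵘ-fromℚᵘ (mkℚᵘ (+ a) b-1)))
      (ℚᵘₚ.≤-respʳ-≃ (ℚᵘₚ.≃-sym (ℚₚ.toℚᵘ-fromℚᵘ (mkℚᵘ (+ c) d-1)))
        (*≤* (subst₂ ℤ._≤_ (ℤₚ.pos-* a d) (ℤₚ.pos-* c b) (ℤ.+≤+ h)))))

  frac-* : ∀ a b c d .{{_ : ℕ.NonZero b}} .{{_ : ℕ.NonZero d}} .{{_ : ℕ.NonZero (b ℕ.* d)}} →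
           (+ a / b) * (+ c / d) ≡ + (a ℕ.* c) / (b ℕ.* d)
  frac-* a b@(suc b-1) c d@(suc d-1) = ℚₚ.toℚᵘ-injective (begin
    toℚᵘ ((+ a / b) * (+ c / d))
      ≈⟨ ℚₚ.toℚᵘ-homo-* (+ a / b) (+ c / d) ⟩
    toℚᵘ (+ a / b) ℚᵘ.* toℚᵘ (+ c / d)
      ≈⟨ ℚᵘₚ.*-cong (ℚₚ.toℚᵘ-fromℚᵘ (mkℚᵘ (+ a) b-1)) (ℚₚ.toℚᵘ-fromℚᵘ (mkℚᵘ (+ c) d-1)) ⟩
    mkℚᵘ (+ a) b-1 ℚᵘ.* mkℚᵘ (+ c) d-1
      ≈⟨ *≡* (cong (ℤ._* + (b ℕ.* d)) (sym (ℤₚ.pos-* a c))) ⟩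
    mkℚᵘ (+ (a ℕ.* c)) (d-1 ℕ.+ b-1 ℕ.* d)
      ≈⟨ ℚₚ.toℚᵘ-fromℚᵘ (mkℚᵘ (+ (a ℕ.* c)) (d-1 ℕ.+ b-1 ℕ.* d)) ⟨
    toℚᵘ (+ (a ℕ.* c) / (b ℕ.* d)) ∎)
    where open import Relation.Binary.Reasoning.Setoid ℚᵘₚ.≃-setoid

  frac-nonneg : ∀ a b .{{_ : ℕ.NonZero b}} → 0ℚ ≤ + a / b
  frac-nonneg a b = ℚₚ.nonNegative⁻¹ (+ a / b) {{ℚₚ.normalize-nonNeg a b}}

  frac-pos : ∀ a b .{{_ : ℕ.NonZero a}} .{{_ : ℕ.NonZero b}} → + a / b ≢ 0ℚ
  frac-pos a b e = ℚₚ.<⇒≢ (ℚₚ.positive⁻¹ (+ a / b) {{ℚₚ.normalize-pos a b}}) (sym e)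

module Valuation (p : ℕ) (pr : Prime p) where

  instance
    p≢0 : ℕ.NonZero p
    p≢0 = prime⇒nonZero pr

  p^k≢0 : ∀ k → ℕ.NonZero (p ^ k)
  p^k≢0 k = ℕₚ.m^n≢0 p k

  -- p^[ j - k ] is the rational p ^ (j - k), where j - k may be negative.
  p^[_-_] : ℕ → ℕ → ℚ
  p^[ j - k ] = (+ (p ^ j) / (p ^ k)) {{p^k≢0 k}}

  largest : ℕ → ℕ → ℕ
  largest n zero    = 0
  largest n (suc k) with p ^ suc k ∣? n
  ... | yes _ = suc k
  ... | no  _ = largest n k

  -- The largest k ≤ n with p ^ k ∣ n.  For n ≠ 0 the bound k ≤ n is no
  -- restriction, since p ^ k > k; v 0 is a dummy value.
  v : ℕ → ℕ
  v n = largest n n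

  -- ∣ a / b ∣ₚ = p ^ (v b - v a), for a and b ≠ 0 not necessarily coprime.
  fracNorm : ℕ → ℕ → ℚ
  fracNorm zero      b = 0ℚ
  fracNorm a@(suc _) b = p^[ v b - v a ]

  ∣_∣ₚ : ℚ → ℚ
  ∣ x ∣ₚ = fracNorm ℤ.∣ ↥ x ∣ (↧ₙ x)

  1<p : 1 ℕ.< p
  1<p = ℕ.nonTrivial⇒n>1 p {{prime⇒nonTrivial pr}}

  p^-cong : ∀ i j k l → i ℕ.+ l ≡ k ℕ.+ j → p^[ i - j ] ≡ p^[ k - l ]
  p^-cong i j k l e = frac-cong (p ^ i) (p ^ j) (p ^ k) (p ^ l) {{p^k≢0 j}} {{p^k≢0 l}}
    (trans (sym (ℕₚ.^-distribˡ-+-* p i l)) (trans (cong (p ^_) e) (ℕₚ.^-distribˡ-+-* p k j)))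

  p^-* : ∀ i j k l → p^[ i ℕ.+ k - j ℕ.+ l ] ≡ p^[ i - j ] * p^[ k - l ]
  p^-* i j k l = sym (trans
    (frac-* (p ^ i) (p ^ j) (p ^ k) (p ^ l) {{p^k≢0 j}} {{p^k≢0 l}} {{jl≢0}})
    (frac-cong (p ^ i ℕ.* p ^ k) (p ^ j ℕ.* p ^ l) (p ^ (i ℕ.+ k)) (p ^ (j ℕ.+ l)) {{jl≢0}} {{p^k≢0 (j ℕ.+ l)}}
      (cong₂ ℕ._*_ (sym (ℕₚ.^-distribˡ-+-* p i k)) (ℕₚ.^-distribˡ-+-* p j l))))
    where
    jl≢0 : ℕ.NonZero (p ^ j ℕ.* p ^ l)
    jl≢0 = ℕₚ.m*n≢0 (p ^ j) (p ^ l) {{p^k≢0 j}} {{p^k≢0 l}}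

  p^-anti : ∀ i {j k} → k ℕ.≤ j → p^[ i - j ] ≤ p^[ i - k ]
  p^-anti i {j} {k} k≤j = frac-mono (p ^ i) (p ^ j) (p ^ i) (p ^ k) {{p^k≢0 j}} {{p^k≢0 k}}
    (ℕₚ.*-monoʳ-≤ (p ^ i) (ℕₚ.^-monoʳ-≤ p k≤j))

  0≤p^ : ∀ j k → 0ℚ ≤ p^[ j - k ]
  0≤p^ j k = frac-nonneg (p ^ j) (p ^ k) {{p^k≢0 k}}

  p^≢0 : ∀ j k → p^[ j - k ] ≢ 0ℚ
  p^≢0 j k = frac-pos (p ^ j) (p ^ k) {{p^k≢0 j}} {{p^k≢0 k}}

  k<p^k : ∀ k → k ℕ.< p ^ k
  k<p^k zero    = ℕ.s≤s ℕ.z≤n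
  k<p^k (suc k) = ℕₚ.≤-<-trans (k<p^k k) (ℕₚ.^-monoʳ-< p 1<p (ℕₚ.n<1+n k))

  largest-∣ : ∀ n b → p ^ largest n b ∣ n
  largest-∣ n zero    = ℕ∣.1∣ n
  largest-∣ n (suc b) with p ^ suc b ∣? n
  ... | yes h = h
  ... | no  _ = largest-∣ n b

  largest-max : ∀ n b k → k ℕ.≤ b → p ^ k ∣ n → k ℕ.≤ largest n b
  largest-max n zero    k k≤b h = k≤b
  largest-max n (suc b) k k≤b h with p ^ suc b ∣? n
  ... | yes _ = k≤b
  ... | no ¬h with ℕₚ.m≤n⇒m<n∨m≡n k≤b
  ...   | inj₁ (ℕ.s≤s k≤b′) = largest-max n b k k≤b′ h
  ...   | inj₂ refl          = ⊥-elim (¬h h)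

  v-∣ : ∀ n → p ^ v n ∣ n
  v-∣ n = largest-∣ n n

  v-max : ∀ n .{{_ : ℕ.NonZero n}} k → p ^ k ∣ n → k ℕ.≤ v n
  v-max n k h = largest-max n n k (ℕₚ.<⇒≤ (ℕₚ.<-≤-trans (k<p^k k) (ℕ∣.∣⇒≤ h))) h

  private
    p^-mono : ∀ {i j} → i ℕ.≤ j → p ^ i ∣ p ^ j
    p^-mono {i} {j} i≤j = subst (λ k → p ^ i ∣ p ^ k) (ℕₚ.m+[n∸m]≡n i≤j)
      (subst (p ^ i ∣_) (sym (ℕₚ.^-distribˡ-+-* p i (j ℕ.∸ i))) (ℕ∣.m∣m*n (p ^ (j ℕ.∸ i))))

    cofactor : ∀ n .{{_ : ℕ.NonZero n}} → ∃[ c ] n ≡ p ^ v n ℕ.* c × ¬ p ∣ c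
    cofactor n with v-∣ n
    ... | divides c n≡ = c , n≡′ , λ where
        (divides d refl) → ℕₚ.<-irrefl refl (v-max n (suc (v n))
          (divides d (trans n≡ (trans (ℕₚ.*-assoc d p (p ^ v n)) refl))))
      where
      n≡′ = trans n≡ (ℕₚ.*-comm c (p ^ v n))

  v-* : ∀ m n .{{_ : ℕ.NonZero m}} .{{_ : ℕ.NonZero n}} → v (m ℕ.* n) ≡ v m ℕ.+ v n
  v-* m n with cofactor m | cofactor n
  ... | c , m≡ , p∤c | d , n≡ , p∤d = ℕₚ.≤-antisym (ℕₚ.≮⇒≥ upper) lower
    where
    instance
      mn≢0 : ℕ.NonZero (m ℕ.* n)
      mn≢0 = ℕₚ.m*n≢0 m n
    mn≡ : m ℕ.* n ≡ p ^ (v m ℕ.+ v n) ℕ.* (c ℕ.* d)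
    mn≡ = begin
      m ℕ.* n                                        ≡⟨ cong₂ ℕ._*_ m≡ n≡ ⟩
      (p ^ v m ℕ.* c) ℕ.* (p ^ v n ℕ.* d)            ≡⟨ ℕₚ.[m*n]*[o*p]≡[m*o]*[n*p] (p ^ v m) c (p ^ v n) d ⟩
      (p ^ v m ℕ.* p ^ v n) ℕ.* (c ℕ.* d)            ≡⟨ cong (ℕ._* (c ℕ.* d)) (ℕₚ.^-distribˡ-+-* p (v m) (v n)) ⟨
      p ^ (v m ℕ.+ v n) ℕ.* (c ℕ.* d)                ∎
      where open ≡-Reasoning
    lower : v m ℕ.+ v n ℕ.≤ v (m ℕ.* n)
    lower = v-max (m ℕ.* n) (v m ℕ.+ v n) (subst (p ^ (v m ℕ.+ v n) ∣_) (sym mn≡) (ℕ∣.m∣m*n (c ℕ.* d)))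
    upper : ¬ (v m ℕ.+ v n ℕ.< v (m ℕ.* n))
    upper h with euclidsLemma c d pr (ℕ∣.*-cancelˡ-∣ (p ^ (v m ℕ.+ v n)) {{p^k≢0 (v m ℕ.+ v n)}}
                   (subst₂ _∣_ (ℕₚ.*-comm p _) mn≡
                     (ℕ∣.∣-trans (p^-mono h) (v-∣ (m ℕ.* n)))))
    ... | inj₁ p∣c = p∤c p∣c
    ... | inj₂ p∣d = p∤d p∣d

  fracNorm-nonneg : ∀ a b → 0ℚ ≤ fracNorm a b
  fracNorm-nonneg zero      b = ℚₚ.≤-refl
  fracNorm-nonneg a@(suc _) b = 0≤p^ (v b) (v a)

  fracNorm-cong : ∀ a b c d .{{_ : ℕ.NonZero b}} .{{_ : ℕ.NonZero d}} →
                  a ℕ.* d ≡ c ℕ.* b → fracNorm a b ≡ fracNorm c d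
  fracNorm-cong zero      b zero      d e = refl
  fracNorm-cong zero      (suc _) (suc _) d       e = ⊥-elim (ℕₚ.0≢1+n e)
  fracNorm-cong (suc _)   b       zero    (suc _) e = ⊥-elim (ℕₚ.1+n≢0 e)
  fracNorm-cong a@(suc _) b       c@(suc _) d     e = p^-cong (v b) (v a) (v d) (v c)
    (trans (ℕₚ.+-comm (v b) (v c)) (trans (sym (v-* c b))
      (trans (cong v (sym e)) (trans (v-* a d) (ℕₚ.+-comm (v a) (v d))))))

  fracNorm-* : ∀ a b c d .{{_ : ℕ.NonZero b}} .{{_ : ℕ.NonZero d}} →
               fracNorm (a ℕ.* c) (b ℕ.* d) ≡ fracNorm a b * fracNorm c d
  fracNorm-* zero      b c         d = sym (ℚₚ.*-zeroˡ (fracNorm c d))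
  fracNorm-* a@(suc _) b zero      d = trans
    (cong (λ k → fracNorm k (b ℕ.* d)) (ℕₚ.*-zeroʳ a)) (sym (ℚₚ.*-zeroʳ (fracNorm a b)))
  fracNorm-* a@(suc _) b c@(suc _) d = trans
    (cong₂ p^[_-_] (v-* b d) (v-* a c)) (p^-* (v b) (v a) (v d) (v c))

  fracNorm-anti : ∀ s a b .{{_ : ℕ.NonZero a}} → p ^ v a ∣ s → fracNorm s b ≤ fracNorm a b
  fracNorm-anti zero      a         b h = fracNorm-nonneg a b
  fracNorm-anti s@(suc _) a@(suc _) b h = p^-anti (v b) (v-max s (v a) h)

  fracNorm-+ : ∀ i j b → fracNorm ℤ.∣ i ℤ.+ j ∣ b ≤ fracNorm ℤ.∣ i ∣ b
                       ⊎ fracNorm ℤ.∣ i ℤ.+ j ∣ b ≤ fracNorm ℤ.∣ j ∣ b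
  fracNorm-+ i j b = by-cases ℤ.∣ i ∣ ℤ.∣ j ∣ refl refl
    where
    both : ∀ {k a c} → ℤ.∣ i ∣ ≡ a → ℤ.∣ j ∣ ≡ c → k ∣ a → k ∣ c → k ∣ ℤ.∣ i ℤ.+ j ∣
    both {k} ei ej h g = ℤ∣.∣⇒∣ᵤ (ℤ∣.∣m∣n⇒∣m+n
      (ℤ∣.∣ᵤ⇒∣ {+ k} {i} (subst (k ∣_) (sym ei) h)) (ℤ∣.∣ᵤ⇒∣ {+ k} {j} (subst (k ∣_) (sym ej) g)))
    nonzero : ∀ a c .{{_ : ℕ.NonZero a}} .{{_ : ℕ.NonZero c}} → ℤ.∣ i ∣ ≡ a → ℤ.∣ j ∣ ≡ c →
              v a ℕ.≤ v c ⊎ v c ℕ.≤ v a →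
              fracNorm ℤ.∣ i ℤ.+ j ∣ b ≤ fracNorm a b ⊎ fracNorm ℤ.∣ i ℤ.+ j ∣ b ≤ fracNorm c b
    nonzero a c ei ej (inj₁ h) = inj₁ (fracNorm-anti ℤ.∣ i ℤ.+ j ∣ a b
      (both ei ej (v-∣ a) (ℕ∣.∣-trans (p^-mono h) (v-∣ c))))
    nonzero a c ei ej (inj₂ h) = inj₂ (fracNorm-anti ℤ.∣ i ℤ.+ j ∣ c b
      (both ei ej (ℕ∣.∣-trans (p^-mono h) (v-∣ a)) (v-∣ c)))
    by-cases : ∀ a c → ℤ.∣ i ∣ ≡ a → ℤ.∣ j ∣ ≡ c →
               fracNorm ℤ.∣ i ℤ.+ j ∣ b ≤ fracNorm a b ⊎ fracNorm ℤ.∣ i ℤ.+ j ∣ b ≤ fracNorm c b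
    by-cases zero c ei ej = inj₂ (ℚₚ.≤-reflexive (cong (λ k → fracNorm k b)
      (trans (cong ℤ.∣_∣ (trans (cong (ℤ._+ j) (ℤₚ.∣i∣≡0⇒i≡0 {i} ei)) (ℤₚ.+-identityˡ j))) ej)))
    by-cases a@(suc _) zero ei ej = inj₁ (ℚₚ.≤-reflexive (cong (λ k → fracNorm k b)
      (trans (cong ℤ.∣_∣ (trans (cong (ℤ._+_ i) (ℤₚ.∣i∣≡0⇒i≡0 {j} ej)) (ℤₚ.+-identityʳ i))) ei)))
    by-cases a@(suc _) c@(suc _) ei ej = nonzero a c ei ej (ℕₚ.≤-total (v a) (v c))

  private
    normᵘ : ℚᵘ → ℚ
    normᵘ (mkℚᵘ n d-1) = fracNorm ℤ.∣ n ∣ (suc d-1)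

    normᵘ-cong : ∀ {x y} → x ℚᵘ.≃ y → normᵘ x ≡ normᵘ y
    normᵘ-cong {mkℚᵘ a b-1} {mkℚᵘ c d-1} (*≡* e) = fracNorm-cong ℤ.∣ a ∣ (suc b-1) ℤ.∣ c ∣ (suc d-1)
      (trans (sym (ℤₚ.abs-* a (+ suc d-1))) (trans (cong ℤ.∣_∣ e) (ℤₚ.abs-* c (+ suc b-1))))

    normᵘ-toℚᵘ : ∀ x → normᵘ (toℚᵘ x) ≡ ∣ x ∣ₚ
    normᵘ-toℚᵘ (mkℚ _ _ _) = refl

    normᵘ-* : ∀ x y → normᵘ (x ℚᵘ.* y) ≡ normᵘ x * normᵘ y
    normᵘ-* (mkℚᵘ a b-1) (mkℚᵘ c d-1) = trans
      (cong (λ k → fracNorm k (suc b-1 ℕ.* suc d-1)) (ℤₚ.abs-* a c))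
      (fracNorm-* ℤ.∣ a ∣ (suc b-1) ℤ.∣ c ∣ (suc d-1))

    normᵘ-+ : ∀ x y → normᵘ (x ℚᵘ.+ y) ≤ normᵘ x ⊎ normᵘ (x ℚᵘ.+ y) ≤ normᵘ y
    normᵘ-+ (mkℚᵘ a b-1) (mkℚᵘ c d-1) = map
      (λ h → ℚₚ.≤-trans h (ℚₚ.≤-reflexive
        (fracNorm-cong ℤ.∣ a ℤ.* + suc d-1 ∣ (suc b-1 ℕ.* suc d-1) ℤ.∣ a ∣ (suc b-1) (trans
          (cong (ℕ._* suc b-1) (ℤₚ.abs-* a (+ suc d-1)))
          (trans (ℕₚ.*-assoc ℤ.∣ a ∣ (suc d-1) (suc b-1))
                 (cong (ℤ.∣ a ∣ ℕ.*_) (ℕₚ.*-comm (suc d-1) (suc b-1))))))))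
      (λ h → ℚₚ.≤-trans h (ℚₚ.≤-reflexive
        (fracNorm-cong ℤ.∣ c ℤ.* + suc b-1 ∣ (suc b-1 ℕ.* suc d-1) ℤ.∣ c ∣ (suc d-1) (trans
          (cong (ℕ._* suc d-1) (ℤₚ.abs-* c (+ suc b-1)))
          (ℕₚ.*-assoc ℤ.∣ c ∣ (suc b-1) (suc d-1))))))
      (fracNorm-+ (a ℤ.* + suc d-1) (c ℤ.* + suc b-1) (suc b-1 ℕ.* suc d-1))

  ∣x*y∣ₚ : ∀ x y → ∣ x * y ∣ₚ ≡ ∣ x ∣ₚ * ∣ y ∣ₚ
  ∣x*y∣ₚ x y = begin
    ∣ x * y ∣ₚ                          ≡⟨ normᵘ-toℚᵘ (x * y) ⟨
    normᵘ (toℚᵘ (x * y))                ≡⟨ normᵘ-cong (ℚₚ.toℚᵘ-homo-* x y) ⟩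
    normᵘ (toℚᵘ x ℚᵘ.* toℚᵘ y)          ≡⟨ normᵘ-* (toℚᵘ x) (toℚᵘ y) ⟩
    normᵘ (toℚᵘ x) * normᵘ (toℚᵘ y)     ≡⟨ cong₂ _*_ (normᵘ-toℚᵘ x) (normᵘ-toℚᵘ y) ⟩
    ∣ x ∣ₚ * ∣ y ∣ₚ                     ∎
    where open ≡-Reasoning

  ultrametric : ∀ x y → ∣ x + y ∣ₚ ≤ ∣ x ∣ₚ ⊎ ∣ x + y ∣ₚ ≤ ∣ y ∣ₚ
  ultrametric x y = subst₂ (λ s t → ∣ x + y ∣ₚ ≤ s ⊎ ∣ x + y ∣ₚ ≤ t) (normᵘ-toℚᵘ x) (normᵘ-toℚᵘ y)
    (subst (λ s → s ≤ normᵘ (toℚᵘ x) ⊎ s ≤ normᵘ (toℚᵘ y))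
      (trans (sym (normᵘ-cong (ℚₚ.toℚᵘ-homo-+ x y))) (normᵘ-toℚᵘ (x + y)))
      (normᵘ-+ (toℚᵘ x) (toℚᵘ y)))

  0≤∣x∣ₚ : ∀ x → 0ℚ ≤ ∣ x ∣ₚ
  0≤∣x∣ₚ x = fracNorm-nonneg ℤ.∣ ↥ x ∣ (↧ₙ x)

  ∣x+y∣ₚ : ∀ x y → ∣ x + y ∣ₚ ≤ ∣ x ∣ₚ + ∣ y ∣ₚ
  ∣x+y∣ₚ x y = by-cases (ultrametric x y)
    where
    by-cases : ∣ x + y ∣ₚ ≤ ∣ x ∣ₚ ⊎ ∣ x + y ∣ₚ ≤ ∣ y ∣ₚ → ∣ x + y ∣ₚ ≤ ∣ x ∣ₚ + ∣ y ∣ₚ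
    by-cases (inj₁ h) = ℚₚ.≤-trans h (subst (_≤ ∣ x ∣ₚ + ∣ y ∣ₚ) (ℚₚ.+-identityʳ ∣ x ∣ₚ)
      (ℚₚ.+-monoʳ-≤ ∣ x ∣ₚ (0≤∣x∣ₚ y)))
    by-cases (inj₂ h) = ℚₚ.≤-trans h (subst (_≤ ∣ x ∣ₚ + ∣ y ∣ₚ) (ℚₚ.+-identityˡ ∣ y ∣ₚ)
      (ℚₚ.+-monoˡ-≤ ∣ y ∣ₚ (0≤∣x∣ₚ x)))

  ∣x∣ₚ≡0⇒x≡0 : ∀ x → ∣ x ∣ₚ ≡ 0ℚ → x ≡ 0ℚ
  ∣x∣ₚ≡0⇒x≡0 x h = by-cases ℤ.∣ ↥ x ∣ refl h
    where
    by-cases : ∀ a → ℤ.∣ ↥ x ∣ ≡ a → fracNorm a (↧ₙ x) ≡ 0ℚ → x ≡ 0ℚ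
    by-cases zero      e h = ℚₚ.↥p≡0⇒p≡0 x (ℤₚ.∣i∣≡0⇒i≡0 {↥ x} e)
    by-cases a@(suc _) e h = ⊥-elim (p^≢0 (v (↧ₙ x)) (v a) h)

  ∣-x∣ₚ≡∣x∣ₚ : ∀ x → ∣ - x ∣ₚ ≡ ∣ x ∣ₚ
  ∣-x∣ₚ≡∣x∣ₚ (mkℚ +[1+ _ ] _ _) = refl
  ∣-x∣ₚ≡∣x∣ₚ (mkℚ (+ 0)    _ _) = refl
  ∣-x∣ₚ≡∣x∣ₚ (mkℚ -[1+ _ ] _ _) = refl

  padic : AbsoluteValue
  padic = record
    { ∥_∥       = ∣_∣ₚ
    ; 0≤∥x∥     = 0≤∣x∣ₚ
    ; ∥0∥≡0     = refl
    ; ∥x∥≡0⇒x≡0 = ∣x∣ₚ≡0⇒x≡0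
    ; ∥x*y∥     = ∣x*y∣ₚ
    ; ∥x+y∥     = ∣x+y∣ₚ
    ; ∥-x∥≡∥x∥  = ∣-x∣ₚ≡∣x∣ₚ
    }

module Padic (p : ℕ) (pr : Prime p) where
  open Valuation p pr public
  open Completion padic public
    using (term; cauchy; _≈_; const; _⊕_; _⊗_; _⊖_; ⊝_)
    renaming (Carrier to ℚₚ; rawRing to ℚₚ-rawRing)
  open Norm padic public using (norm; Tendsto)

  -- partialSum k c n = ∑ (j < n) c j · p ^ (j - k)
  partialSum : ℕ → (ℕ → Fin p) → ℕ → ℚ
  partialSum k c zero    = 0ℚ
  partialSum k c (suc n) = partialSum k c n + (+ toℕ (c n) / 1) * p^[ n - k ]

  -- u = ∑ (j ≥ 0) c j · p ^ (j - k): the digit of u at p ^ i is c (i + k), and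
  -- all digits below p ^ (- k) vanish.  Leading zeros are allowed.
  record DigitExpansion (u : ℚₚ) : Set where
    field
      k   : ℕ
      c   : ℕ → Fin p
      sum : Tendsto (λ n → const (partialSum k c n)) u

  -- r = ⌊ u ⌋ₚ, the part of the expansion with exponents j - k ≤ 0.
  IsFloor : ℚₚ → ℚ → Set
  IsFloor u r = Σ[ e ∈ DigitExpansion u ]
    let open DigitExpansion e in r ≡ partialSum k c (suc k)

fieldRawRing : ∀ {a ℓ₁ ℓ₂} → HeytingField a ℓ₁ ℓ₂ → RawRing a ℓ₁
fieldRawRing K = CommutativeRing.rawRing
  (HeytingCommutativeRing.commutativeRing (HeytingField.heytingCommutativeRing K))

record Embedding {a ℓ₁ ℓ₂ b ℓ} (K : HeytingField a ℓ₁ ℓ₂) (R : RawRing b ℓ) :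
                 Set (a ⊔ ℓ₁ ⊔ b ⊔ ℓ) where
  field
    ⟦_⟧                : HeytingField.Carrier K → RawRing.Carrier R
    isRingMonomorphism : RingMorphisms.IsRingMonomorphism (fieldRawRing K) R ⟦_⟧

record Mat₂ : Set where
  constructor mat
  field
    e₀₀ e₀₁ e₁₀ e₁₁ : ℚ

infixl 7 _·_
_·_ : Mat₂ → Mat₂ → Mat₂
mat a b c d · mat a′ b′ c′ d′ =
  mat (a * a′ + b * c′) (a * b′ + b * d′) (c * a′ + d * c′) (c * b′ + d * d′)

step : ℚ → Mat₂
step b = mat b 1ℚ 1ℚ 0ℚ

convergentMatrix : (ℕ → ℚ) → ℕ → Mat₂
convergentMatrix b zero    = step (b 0)
convergentMatrix b (suc n) = convergentMatrix b n · step (b (suc n))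

numer denom : (ℕ → ℚ) → ℕ → ℚ
numer b n = Mat₂.e₀₀ (convergentMatrix b n)
denom b n = Mat₂.e₁₀ (convergentMatrix b n)

convergent : (b : ℕ → ℚ) (n : ℕ) → denom b n ≢ 0ℚ → ℚ
convergent b n q≢0 = (numer b n ÷ denom b n) {{ℚ.≢-nonZero q≢0}}

module Algorithm
  {a ℓ₁ ℓ₂ : Level} (p : ℕ) (pr : Prime p) (K : HeytingField a ℓ₁ ℓ₂)
  (σ∞ : Embedding K Real.rawRing) (σₚ : Embedding K (Padic.ℚₚ-rawRing p pr)) where

  open Padic p pr using (ℚₚ; IsFloor; Tendsto) renaming (const to constₚ; _≈_ to _≈ₚ_)
  private
    module K = HeytingField K

  ⟦_⟧∞ : K.Carrier → ℝ
  ⟦_⟧∞ = Embedding.⟦_⟧ σ∞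

  ⟦_⟧ₚ : K.Carrier → ℚₚ
  ⟦_⟧ₚ = Embedding.⟦_⟧ σₚ

  fromℤ : ℤ → K.Carrier
  fromℤ (+ n)    = RawMonoidDefinitions._×_ (RawRing.+-rawMonoid (fieldRawRing K)) n K.1#
  fromℤ -[1+ n ] = K.- fromℤ (+ suc n)

  -- x is the image of r under ℚ → K.  As K embeds into ℝ it has characteristic
  -- 0, so the equation determines x from r and r from x.
  infix 4 _represents_
  _represents_ : K.Carrier → ℚ → Set ℓ₁
  x represents r = (fromℤ (↧ r) K.* x) K.≈ fromℤ (↥ r)

  -- ∣ α∞ - i s - r ∣
  distance : K.Carrier → ℕ → ℚ → ℤ → ℝ
  distance α s r i =
    ∣ ⟦ α ⟧∞ Real.⊖ Real.const ((i ℤ.* + s) / 1) Real.⊖ Real.const r ∣ℝ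

  Minimises : K.Carrier → ℕ → ℚ → ℤ → Set
  Minimises α s r i = ∀ j → distance α s r i ≤ℝ distance α s r j

  IsLeastMinimiser : K.Carrier → ℕ → ℚ → ℤ → Set
  IsLeastMinimiser α s r m = Minimises α s r m × (∀ i → Minimises α s r i → m ℤ.≤ i)

  spacing : Fin 2 → ℕ
  spacing zero    = p
  spacing (suc _) = 1

  -- b = b⁽ᵋ⁾(α), where r = ⌊ α ⌋ₚ and b = m p + r for ε = 0, b = m + r for ε = 1.
  -- A relation rather than a function: neither comparison of reals nor the
  -- choice of a minimiser is computable.
  IsPartialQuotient : Fin 2 → K.Carrier → ℚ → Set
  IsPartialQuotient ε α b = ∃[ r ] ∃[ m ]
    IsFloor ⟦ α ⟧ₚ r
    × IsLeastMinimiser α (spacing ε) r m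
    × b ≡ (m ℤ.* + spacing ε) / 1 + r

  -- β = 1 / (α - b); such a β exists exactly when α ≠ b.
  IsReciprocal : K.Carrier → ℚ → K.Carrier → Set (a ⊔ ℓ₁)
  IsReciprocal α b β = ∃[ x ] x represents b × (β K.* (α K.- x)) K.≈ K.1#

  Advances : (ℕ → K.Carrier) → (ℕ → ℚ) → ℕ → Set (a ⊔ ℓ₁)
  Advances αs bs n = IsPartialQuotient (n mod 2) (αs n) (bs n) × IsReciprocal (αs n) (bs n) (αs (suc n))

  Halts : (ℕ → K.Carrier) → (ℕ → ℚ) → ℕ → Set ℓ₁
  Halts αs bs n = IsPartialQuotient (n mod 2) (αs n) (bs n) × αs n represents bs n

  -- An execution of the algorithm on α.  For one that halts at stage N, only
  -- the terms of αs and bs with index at most N are meaningful.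
  data Run (α : K.Carrier) : Set (a ⊔ ℓ₁) where
    forever : (αs : ℕ → K.Carrier) (bs : ℕ → ℚ) → αs 0 K.≈ α →
              (∀ n → Advances αs bs n) → Run α
    halting : (N : ℕ) (αs : ℕ → K.Carrier) (bs : ℕ → ℚ) → αs 0 K.≈ α →
              (∀ n → n ℕ.< N → Advances αs bs n) → Halts αs bs N → Run α

  -- The convergents of the run are defined and their limit is u.
  ConvergentsTendTo : ∀ {α} → Run α → ℚₚ → Set
  ConvergentsTendTo (forever αs bs _ _) u =
    Σ[ q≢0 ∈ (∀ n → denom bs n ≢ 0ℚ) ] Tendsto (λ n → constₚ (convergent bs n (q≢0 n))) u
  ConvergentsTendTo (halting N αs bs _ _ _) u =
    Σ[ q≢0 ∈ (∀ n → n ℕ.≤ N → denom bs n ≢ 0ℚ) ] constₚ (convergent bs N (q≢0 N ℕₚ.≤-refl)) ≈ₚ u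

{-# OPTIONS --safe #-}

-- Put δ n = ∣ p ∣ for n even and δ n = 1 for n odd.  The floor gives
-- ∣ αₙ - bₙ ∣ ≤ δ n, whatever multiple of the spacing is added to it, so the
-- real embedding plays no part.  From αₙ₊₁ (αₙ - bₙ) = 1 and
-- δ (n + 1) δ n = ∣ p ∣ < 1 one gets ∣ bₙ₊₁ ∣ ≥ 1 / δ n, and then ∣ qₙ ∣ ≥ 1 by
-- induction.  The same relation yields
--   qₙ α - pₙ = - (b₀ - α₀) ⋯ (bₙ - αₙ),
-- whose norm is at most δ 0 ⋯ δ n, which tends to 0 and bounds ∣ pₙ / qₙ - α ∣.
-- When the algorithm halts at N, the last factor vanishes and p_N / q_N = α.

module Submission where

open import Defs
open import Level using (Level)
open import Data.Nat.Base using (ℕ)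
open import Data.Nat.Primality using (Prime)
open import Algebra.Apartness.Bundles using (HeytingField)

open import Algebra.Morphism.Structures using (module RingMorphisms)
open import Data.Empty using (⊥-elim)
open import Data.Fin.Base using (Fin; zero; suc; toℕ)
open import Data.Integer.Base as ℤ using (ℤ; +_; -[1+_]; +[1+_])
import Data.Integer.Properties as ℤₚ
open import Data.Nat.Base as ℕ using (zero; suc; _^_; ⌊_/2⌋)
import Data.Nat.Divisibility as ℕ∣
open import Data.Nat.DivMod using (_mod_)
import Data.Nat.Properties as ℕₚ
open import Data.Product.Base using (∃-syntax; _×_; _,_; proj₁; proj₂)
open import Data.Rational.Base as ℚ
  using (ℚ; mkℚ; 0ℚ; 1ℚ; ½; _+_; _*_; _-_; -_; _/_; _÷_; 1/_; _≤_; _<_; *<*; ↥_; ↧_; ↧ₙ_; toℚᵘ)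
import Data.Rational.Properties as ℚₚ
open import Data.Rational.Solver using (module +-*-Solver)
open import Data.Rational.Unnormalised.Base as ℚᵘ using (mkℚᵘ; *≡*; *<*)
import Data.Rational.Unnormalised.Properties as ℚᵘₚ
open import Data.Sum.Base using (_⊎_; [_,_]′)
open import Function.Base using (_∘_)
import Relation.Binary.Reasoning.Setoid as SetoidReasoning
open import Relation.Binary.Bundles using (Setoid)
open import Relation.Binary.PropositionalEquality
  using (_≡_; _≢_; refl; sym; trans; cong; cong₂; subst; subst₂; module ≡-Reasoning)
open import Relation.Nullary using (¬_)

-- Ordered-field facts and fractions over the rationals

*-mono-≤ : ∀ {a b c d} → 0ℚ ≤ b → 0ℚ ≤ c → a ≤ c → b ≤ d → a * b ≤ c * d
*-mono-≤ {b = b} {c = c} 0≤b 0≤c a≤c b≤d = ℚₚ.≤-trans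
  (ℚₚ.*-monoʳ-≤-nonNeg b {{ℚ.nonNegative 0≤b}} a≤c)
  (ℚₚ.*-monoˡ-≤-nonNeg c {{ℚ.nonNegative 0≤c}} b≤d)

0<⇒*-pos : ∀ {a b} → 0ℚ < a → 0ℚ < b → 0ℚ < a * b
0<⇒*-pos {a} {b} 0<a 0<b =
  subst (_< a * b) (ℚₚ.*-zeroʳ a) (ℚₚ.*-monoʳ-<-pos a {{ℚ.positive 0<a}} 0<b)

<⇒≱ : ∀ {a b} → a < b → ¬ (b ≤ a)
<⇒≱ a<b b≤a = ℚₚ.<-irrefl refl (ℚₚ.<-≤-trans a<b b≤a)

0<1 : 0ℚ < 1ℚ
0<1 = ℚₚ.positive⁻¹ 1ℚ

x*[y÷x] : ∀ x y (x≢0 : x ≢ 0ℚ) → x * (y ÷ x) {{ℚ.≢-nonZero x≢0}} ≡ y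
x*[y÷x] x y x≢0 = begin
  x * (y * 1/ x)  ≡⟨ solve 3 (λ x y z → x :* (y :* z) := y :* (x :* z)) refl x y (1/ x) ⟩
  y * (x * 1/ x)  ≡⟨ cong (y *_) (ℚₚ.*-inverseʳ x) ⟩
  y * 1ℚ          ≡⟨ ℚₚ.*-identityʳ y ⟩
  y               ∎
  where
  open ≡-Reasoning
  open +-*-Solver
  instance
    x-nonZero : ℚ.NonZero x
    x-nonZero = ℚ.≢-nonZero x≢0

divide : ∀ {a ε} → 0ℚ < a → 0ℚ < ε → ∃[ δ ] 0ℚ < δ × a * δ ≡ ε
divide {a} {ε} 0<a 0<ε = (ε ÷ a) {{ℚ.≢-nonZero a≢0}} , 0<δ , x*[y÷x] a ε a≢0
  where
  a≢0 : a ≢ 0ℚ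
  a≢0 = ℚₚ.<⇒≢ 0<a ∘ sym
  instance
    a-pos : ℚ.Positive a
    a-pos = ℚ.positive 0<a
  0<δ : 0ℚ < (ε ÷ a) {{ℚ.≢-nonZero a≢0}}
  0<δ = 0<⇒*-pos 0<ε (ℚₚ.positive⁻¹ ((1/ a) {{ℚ.≢-nonZero a≢0}}) {{ℚₚ.1/pos⇒pos a}})

-- A positive rational in lowest terms has numerator at least 1, so it is at least the reciprocal of
-- its denominator, which exceeds `1 / n`.
1/n<ε : ∀ {ε} n .{{_ : ℕ.NonZero n}} → 0ℚ < ε → ↧ₙ ε ℕ.< n → + 1 / n < ε
1/n<ε {mkℚ -[1+ _ ] _ _} (suc _) (*<* ())
1/n<ε {mkℚ (+ 0) _ _} (suc _) (*<* (ℤ.+<+ ()))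
1/n<ε {ε@(mkℚ +[1+ a ] d-1 _)} n@(suc n-1) _ d<n = ℚₚ.toℚᵘ-cancel-<
  (ℚᵘₚ.<-respˡ-≃ (ℚᵘₚ.≃-sym (ℚₚ.toℚᵘ-fromℚᵘ (mkℚᵘ (+ 1) n-1)))
    (*<* (ℤ.+<+ (ℕₚ.<-≤-trans (subst (ℕ._< n) (sym (ℕₚ.+-identityʳ (suc d-1))) d<n)
      (ℕₚ.m≤n*m n (suc a))))))

+-/1 : ∀ i j → (i / 1) + (j / 1) ≡ (i ℤ.+ j) / 1
+-/1 i j = ℚₚ.toℚᵘ-injective (begin
  toℚᵘ ((i / 1) + (j / 1))            ≈⟨ ℚₚ.toℚᵘ-homo-+ (i / 1) (j / 1) ⟩
  toℚᵘ (i / 1) ℚᵘ.+ toℚᵘ (j / 1)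
    ≈⟨ ℚᵘₚ.+-cong (ℚₚ.toℚᵘ-fromℚᵘ (mkℚᵘ i 0)) (ℚₚ.toℚᵘ-fromℚᵘ (mkℚᵘ j 0)) ⟩
  mkℚᵘ i 0 ℚᵘ.+ mkℚᵘ j 0
    ≈⟨ *≡* (cong (ℤ._* + 1) (cong₂ ℤ._+_ (ℤₚ.*-identityʳ i) (ℤₚ.*-identityʳ j))) ⟩
  mkℚᵘ (i ℤ.+ j) 0                    ≈⟨ ℚₚ.toℚᵘ-fromℚᵘ (mkℚᵘ (i ℤ.+ j) 0) ⟨
  toℚᵘ ((i ℤ.+ j) / 1)                ∎)
  where open SetoidReasoning ℚᵘₚ.≃-setoid

↧/1*r : ∀ r → (↧ r / 1) * r ≡ ↥ r / 1
↧/1*r r@(mkℚ n d-1 _) = ℚₚ.toℚᵘ-injective (begin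
  toℚᵘ ((↧ r / 1) * r)             ≈⟨ ℚₚ.toℚᵘ-homo-* (↧ r / 1) r ⟩
  toℚᵘ (↧ r / 1) ℚᵘ.* toℚᵘ r       ≈⟨ ℚᵘₚ.*-congʳ (ℚₚ.toℚᵘ-fromℚᵘ (mkℚᵘ (↧ r) 0)) ⟩
  mkℚᵘ (↧ r) 0 ℚᵘ.* mkℚᵘ n d-1     ≈⟨ *≡* (trans (ℤₚ.*-identityʳ (↧ r ℤ.* n))
    (trans (ℤₚ.*-comm (↧ r) n) (cong (n ℤ.*_) (sym (ℤₚ.*-identityˡ (↧ r)))))) ⟩
  mkℚᵘ n 0                         ≈⟨ ℚₚ.toℚᵘ-fromℚᵘ (mkℚᵘ n 0) ⟨
  toℚᵘ (↥ r / 1)                   ∎)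
  where open SetoidReasoning ℚᵘₚ.≃-setoid

-- Polynomial identities

module _ where
  open +-*-Solver

  telescope : ∀ x y z → (x - y) + (y - z) ≡ x - z
  telescope = solve 3 (λ x y z → (x :- y) :+ (y :- z) := x :- z) refl

  +-regroup : ∀ w x y z → (w - x) + (y - z) ≡ (w + y) - (x + z)
  +-regroup = solve 4 (λ w x y z → (w :- x) :+ (y :- z) := (w :+ y) :- (x :+ z)) refl

  neg-regroup : ∀ x y → - (x - y) ≡ (- x) - (- y)
  neg-regroup = solve 2 (λ x y → :- (x :- y) := (:- x) :- (:- y)) refl

  neg-swap : ∀ x y → - (x - y) ≡ y - x
  neg-swap = solve 2 (λ x y → :- (x :- y) := y :- x) refl

  [x-y]+y≡x : ∀ x y → (x - y) + y ≡ x
  [x-y]+y≡x = solve 2 (λ x y → (x :- y) :+ y := x) refl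

  append : ∀ x y z → (x - z) + y ≡ (x + y) - z
  append = solve 3 (λ x y z → (x :- z) :+ y := (x :+ y) :- z) refl

  subtract-sum : ∀ x y z → (x - z) + (- y) ≡ x - (y + z)
  subtract-sum = solve 3 (λ x y z → (x :- z) :+ (:- y) := x :- (y :+ z)) refl

  factor : ∀ x y z → x * y - x * z ≡ x * (y - z)
  factor = solve 3 (λ x y z → x :* y :- x :* z := x :* (y :- z)) refl

  halves : ∀ x → ½ * x + ½ * x ≡ x
  halves = solve 1 (λ x → con ½ :* x :+ con ½ :* x := x) refl

  expand : ∀ b′ x′ b x r →
    (b′ - x′) * ((b - x) * r) ≡ b′ * ((b - x) * r) + x′ * (x - b) * r
  expand = solve 5 (λ b′ x′ b x r →
    (b′ :- x′) :* ((b :- x) :* r) := b′ :* ((b :- x) :* r) :+ x′ :* (x :- b) :* r) refl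

  first : ∀ b x → (b - x) * (- 1ℚ) ≡ x - b
  first = solve 2 (λ b x → (b :- x) :* con (- 1ℚ) := x :- b) refl

  zeroth : ∀ u → 0ℚ * u - 1ℚ ≡ - 1ℚ
  zeroth = solve 1 (λ u → con 0ℚ :* u :- con 1ℚ := con (- 1ℚ)) refl

  collect : ∀ b p₀ p₁ q₀ q₁ u →
    b * (q₀ * u - p₀) + (q₁ * u - p₁) ≡ (q₀ * b + q₁ * 1ℚ) * u - (p₀ * b + p₁ * 1ℚ)
  collect = solve 6 (λ b p₀ p₁ q₀ q₁ u →
    b :* (q₀ :* u :- p₀) :+ (q₁ :* u :- p₁) :=
    (q₀ :* b :+ q₁ :* con 1ℚ) :* u :- (p₀ :* b :+ p₁ :* con 1ℚ)) refl

  shift : ∀ x y → x ≡ x * 1ℚ + y * 0ℚ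
  shift = solve 2 (λ x y → x := x :* con 1ℚ :+ y :* con 0ℚ) refl

  split-1 : ∀ x z b → b * z + ((x - b) * z - (x * z - 1ℚ)) ≡ 1ℚ
  split-1 = solve 3 (λ x z b →
    b :* z :+ ((x :- b) :* z :- (x :* z :- con 1ℚ)) := con 1ℚ) refl

  rotate : ∀ x y z → x * (y * z) ≡ z * (x * y)
  rotate = solve 3 (λ x y z → x :* (y :* z) := z :* (x :* y)) refl

  peel : ∀ x y → (x + y * 1ℚ) - y ≡ x
  peel = solve 2 (λ x y → (x :+ y :* con 1ℚ) :- y := x) refl

  unlinear : ∀ q c u → - (q * u - q * c) ≡ q * (c - u)
  unlinear = solve 3 (λ q c u → :- (q :* u :- q :* c) := q :* (c :- u)) refl

  vanish : ∀ x y → 0ℚ * x + y ≡ y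
  vanish = solve 2 (λ x y → con 0ℚ :* x :+ y := y) refl

-- The completion at an ultrametric absolute value

Ultrametric : AbsoluteValue → Set
Ultrametric A = ∀ x y → ∥ x + y ∥ ≤ ∥ x ∥ ⊎ ∥ x + y ∥ ≤ ∥ y ∥
  where open AbsoluteValue A

module UltrametricCompletion (A : AbsoluteValue) (ultrametric : Ultrametric A) where
  open AbsoluteValue A
  open Completion A
  open Norm A using (norm; Tendsto)

  ultrametric-≤ : ∀ {c} x y → ∥ x ∥ ≤ c → ∥ y ∥ ≤ c → ∥ x + y ∥ ≤ c
  ultrametric-≤ x y x≤c y≤c =
    [ (λ h → ℚₚ.≤-trans h x≤c) , (λ h → ℚₚ.≤-trans h y≤c) ]′ (ultrametric x y)

  ultrametric-< : ∀ {c} x y → ∥ x ∥ < c → ∥ y ∥ < c → ∥ x + y ∥ < c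
  ultrametric-< x y x<c y<c =
    [ (λ h → ℚₚ.≤-<-trans h x<c) , (λ h → ℚₚ.≤-<-trans h y<c) ]′ (ultrametric x y)

  ∥x-y∥≡∥y-x∥ : ∀ x y → ∥ x - y ∥ ≡ ∥ y - x ∥
  ∥x-y∥≡∥y-x∥ x y = trans (sym (∥-x∥≡∥x∥ (x - y)))
    (cong ∥_∥ (neg-swap x y))

  pointwise : ∀ {x y} → (∀ t → term x t ≡ term y t) → x ≈ y
  pointwise {x} {y} x≡y ε 0<ε = 0 , λ t _ → subst (_< ε) (sym (trans
    (cong ∥_∥ (trans (cong (_- term y t) (x≡y t)) (ℚₚ.+-inverseʳ (term y t)))) ∥0∥≡0)) 0<ε

  ≈-refl : ∀ {x} → x ≈ x
  ≈-refl {x} = pointwise {x} {x} (λ _ → refl)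

  ≈-sym : ∀ {x y} → x ≈ y → y ≈ x
  ≈-sym {x} {y} x≈y ε 0<ε with x≈y ε 0<ε
  ... | N , close = N , λ t N≤t → subst (_< ε) (∥x-y∥≡∥y-x∥ (term x t) (term y t)) (close t N≤t)

  ≈-trans : ∀ {x y z} → x ≈ y → y ≈ z → x ≈ z
  ≈-trans {x} {y} {z} x≈y y≈z ε 0<ε with x≈y ε 0<ε | y≈z ε 0<ε
  ... | M , xy | N , yz = M ℕ.⊔ N , λ t h → subst (λ d → ∥ d ∥ < ε)
    (telescope (term x t) (term y t) (term z t))
    (ultrametric-< (term x t - term y t) (term y t - term z t)
      (xy t (ℕₚ.m⊔n≤o⇒m≤o M N h)) (yz t (ℕₚ.m⊔n≤o⇒n≤o M N h)))

  ≈-setoid : Setoid _ _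
  ≈-setoid = record
    { Carrier = Carrier
    ; _≈_ = _≈_
    ; isEquivalence = record
      { refl = λ {x} → ≈-refl {x}
      ; sym = λ {x} {y} → ≈-sym {x} {y}
      ; trans = λ {x} {y} {z} → ≈-trans {x} {y} {z}
      }
    }

  ⊕-cong : ∀ {w x y z} → w ≈ x → y ≈ z → w ⊕ y ≈ x ⊕ z
  ⊕-cong {w} {x} {y} {z} w≈x y≈z ε 0<ε with w≈x ε 0<ε | y≈z ε 0<ε
  ... | M , wx | N , yz = M ℕ.⊔ N , λ t h → subst (λ d → ∥ d ∥ < ε)
    (+-regroup (term w t) (term x t) (term y t) (term z t))
    (ultrametric-< (term w t - term x t) (term y t - term z t)
      (wx t (ℕₚ.m⊔n≤o⇒m≤o M N h)) (yz t (ℕₚ.m⊔n≤o⇒n≤o M N h)))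

  ⊝-cong : ∀ {x y} → x ≈ y → ⊝ x ≈ ⊝ y
  ⊝-cong {x} {y} x≈y ε 0<ε with x≈y ε 0<ε
  ... | N , close = N , λ t N≤t → subst (_< ε)
    (trans (sym (∥-x∥≡∥x∥ (term x t - term y t)))
      (cong ∥_∥ (neg-regroup (term x t) (term y t))))
    (close t N≤t)

  ⊖-cong : ∀ {w x y z} → w ≈ x → y ≈ z → w ⊖ y ≈ x ⊖ z
  ⊖-cong {w} {x} {y} {z} w≈x y≈z =
    ⊕-cong {w} {x} {⊝ y} {⊝ z} w≈x (⊝-cong {y} {z} y≈z)

  infix 4 _≼_
  -- Encodes "the norm of `x` is at most `c`" by an eventual bound on the rational terms. This
  -- implies the inequality between reals and lets all estimates be made in `ℚ`.
  _≼_ : Carrier → ℚ → Set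
  x ≼ c = ∃[ N ] ∀ t → N ℕ.≤ t → ∥ term x t ∥ ≤ c

  const-≼ : ∀ {q c} → ∥ q ∥ ≤ c → const q ≼ c
  const-≼ q≤c = 0 , λ _ _ → q≤c

  ≼-trans : ∀ {x c d} → x ≼ c → c ≤ d → x ≼ d
  ≼-trans (N , x≤c) c≤d = N , λ t N≤t → ℚₚ.≤-trans (x≤c t N≤t) c≤d

  -- Eventually the two representatives differ by less than `c`, and the ultrametric inequality then
  -- preserves the bound `c` without loss. Positivity of `c` matters: `x ≼ 0ℚ` would force the terms
  -- to be eventually 0, which depends on the representative.
  ≼-resp-≈ : ∀ {x y c} → 0ℚ < c → x ≈ y → x ≼ c → y ≼ c
  ≼-resp-≈ {x} {y} {c} 0<c x≈y (M , x≤c) = combine (≈-sym {x} {y} x≈y c 0<c)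
    where
    combine : (∃[ N ] ∀ t → N ℕ.≤ t → ∥ term y t - term x t ∥ < c) → y ≼ c
    combine (N , close) = M ℕ.⊔ N , bd
      where
      bd : ∀ t → M ℕ.⊔ N ℕ.≤ t → ∥ term y t ∥ ≤ c
      bd t h = subst (λ d → ∥ d ∥ ≤ c) ([x-y]+y≡x (term y t) (term x t)) bd₁
        where
        bd₁ : ∥ (term y t - term x t) + term x t ∥ ≤ c
        bd₁ = ultrametric-≤ (term y t - term x t) (term x t) bd₂ bd₃
          where
          bd₂ : ∥ term y t - term x t ∥ ≤ c
          bd₂ = ℚₚ.<⇒≤ (close t (ℕₚ.m⊔n≤o⇒n≤o M N h))
          bd₃ : ∥ term x t ∥ ≤ c
          bd₃ = x≤c t (ℕₚ.m⊔n≤o⇒m≤o M N h)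

  ⊕-≼ : ∀ {x y c} → x ≼ c → y ≼ c → x ⊕ y ≼ c
  ⊕-≼ {x} {y} (M , x≤c) (N , y≤c) = M ℕ.⊔ N , λ t h → ultrametric-≤ (term x t) (term y t)
    (x≤c t (ℕₚ.m⊔n≤o⇒m≤o M N h)) (y≤c t (ℕₚ.m⊔n≤o⇒n≤o M N h))

  ⊝-≼ : ∀ {x c} → x ≼ c → ⊝ x ≼ c
  ⊝-≼ {x} {c} (N , x≤c) =
    N , λ t N≤t → subst (_≤ c) (sym (∥-x∥≡∥x∥ (term x t))) (x≤c t N≤t)

  ⊗-≼ : ∀ {x y c d} → 0ℚ ≤ c → x ≼ c → y ≼ d → x ⊗ y ≼ c * d
  ⊗-≼ {x} {y} {c} {d} 0≤c (M , x≤c) (N , y≤d) = M ℕ.⊔ N , λ t h → subst (_≤ c * d)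
    (sym (∥x*y∥ (term x t) (term y t)))
    (*-mono-≤ (0≤∥x∥ (term y t)) 0≤c (x≤c t (ℕₚ.m⊔n≤o⇒m≤o M N h)) (y≤d t (ℕₚ.m⊔n≤o⇒n≤o M N h)))

  bounded : ∀ x → ∃[ c ] 0ℚ < c × x ≼ c
  bounded x with cauchy x 1ℚ 0<1
  -- The summand 1 absorbs the Cauchy tail and also makes the bound positive, so that it can serve
  -- as a divisor.
  ... | N , close = 1ℚ + ∥ term x N ∥ , ℚₚ.+-mono-<-≤ 0<1 (0≤∥x∥ (term x N)) ,
    N , λ t N≤t → subst (λ d → ∥ d ∥ ≤ 1ℚ + ∥ term x N ∥)
      ([x-y]+y≡x (term x t) (term x N))
      (ℚₚ.≤-trans (∥x+y∥ (term x t - term x N) (term x N))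
        (ℚₚ.+-monoˡ-≤ ∥ term x N ∥ (ℚₚ.<⇒≤ (close t N N≤t ℕₚ.≤-refl))))

  ⊗-congˡ : ∀ {x y z} → y ≈ z → x ⊗ y ≈ x ⊗ z
  ⊗-congˡ {x} {y} {z} y≈z ε 0<ε = scale (bounded x)
    where
    scale : ∃[ c ] 0ℚ < c × x ≼ c → ∃[ N ] ∀ t → N ℕ.≤ t → ∥ term x t * term y t - term x t * term z t ∥ < ε
    scale (c , 0<c , M , x≤c) = let δ , 0<δ , cδ≡ε = divide 0<c 0<ε ; N , close = y≈z δ 0<δ in
      M ℕ.⊔ N , λ t h → begin-strict
        ∥ term x t * term y t - term x t * term z t ∥
          ≡⟨ cong ∥_∥ (factor (term x t) (term y t) (term z t)) ⟩
        ∥ term x t * (term y t - term z t) ∥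
          ≡⟨ ∥x*y∥ (term x t) (term y t - term z t) ⟩
        ∥ term x t ∥ * ∥ term y t - term z t ∥
          ≤⟨ ℚₚ.*-monoʳ-≤-nonNeg ∥ term y t - term z t ∥
               {{ℚ.nonNegative (0≤∥x∥ (term y t - term z t))}} {∥ term x t ∥} {c}
               (x≤c t (ℕₚ.m⊔n≤o⇒m≤o M N h)) ⟩
        c * ∥ term y t - term z t ∥
          <⟨ ℚₚ.*-monoʳ-<-pos c {{ℚ.positive 0<c}} {∥ term y t - term z t ∥} {δ}
               (close t (ℕₚ.m⊔n≤o⇒n≤o M N h)) ⟩
        c * δ
          ≡⟨ cδ≡ε ⟩
        ε ∎
      where open ℚₚ.≤-Reasoning

  ⊗-comm : ∀ x y → x ⊗ y ≈ y ⊗ x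
  ⊗-comm x y = pointwise {x ⊗ y} {y ⊗ x} (λ t → ℚₚ.*-comm (term x t) (term y t))

  ⊗-congʳ : ∀ {x y z} → x ≈ y → x ⊗ z ≈ y ⊗ z
  ⊗-congʳ {x} {y} {z} x≈y = begin
    x ⊗ z  ≈⟨ ⊗-comm x z ⟩
    z ⊗ x  ≈⟨ ⊗-congˡ {z} {x} {y} x≈y ⟩
    z ⊗ y  ≈⟨ ⊗-comm z y ⟩
    y ⊗ z  ∎
    where open SetoidReasoning ≈-setoid

  const-⊗-cancel : ∀ {q x y} → q ≢ 0ℚ → const q ⊗ x ≈ const q ⊗ y → x ≈ y
  const-⊗-cancel {q} {x} {y} q≢0 qx≈qy = begin
    x                           ≈⟨ undo x ⟩
    const 1/q ⊗ (const q ⊗ x)   ≈⟨ ⊗-congˡ {const 1/q} {const q ⊗ x} {const q ⊗ y} qx≈qy ⟩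
    const 1/q ⊗ (const q ⊗ y)   ≈⟨ undo y ⟨
    y                           ∎
    where
    1/q : ℚ
    1/q = (1/ q) {{ℚ.≢-nonZero q≢0}}
    undo : ∀ z → z ≈ const 1/q ⊗ (const q ⊗ z)
    undo z = pointwise {z} {const 1/q ⊗ (const q ⊗ z)} (λ t → sym (cancel (term z t)))
      where
      open ≡-Reasoning
      cancel : ∀ r → 1/q * (q * r) ≡ r
      cancel r = begin
        1/q * (q * r)   ≡⟨ ℚₚ.*-assoc 1/q q r ⟨
        1/q * q * r     ≡⟨ cong (_* r) (ℚₚ.*-inverseˡ q {{ℚ.≢-nonZero q≢0}}) ⟩
        1ℚ * r          ≡⟨ ℚₚ.*-identityˡ r ⟩
        r               ∎
    open SetoidReasoning ≈-setoid

  -- Multiplicativity makes `∥ 1ℚ ∥` idempotent, and it is positive, so it can be cancelled.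
  ∥1∥≡1 : ∥ 1ℚ ∥ ≡ 1ℚ
  ∥1∥≡1 = ℚₚ.≤-antisym
    (ℚₚ.*-cancelˡ-≤-pos {∥ 1ℚ ∥} {1ℚ} ∥ 1ℚ ∥ (ℚₚ.≤-reflexive ∥1∥*∥1∥≡∥1∥*1))
    (ℚₚ.*-cancelˡ-≤-pos {1ℚ} {∥ 1ℚ ∥} ∥ 1ℚ ∥ (ℚₚ.≤-reflexive (sym ∥1∥*∥1∥≡∥1∥*1)))
    where
    1≢0 : 1ℚ ≢ 0ℚ
    1≢0 ()
    instance
      ∥1∥-pos : ℚ.Positive ∥ 1ℚ ∥
      ∥1∥-pos = ℚₚ.nonNeg∧nonZero⇒pos ∥ 1ℚ ∥
        {{ℚ.nonNegative (0≤∥x∥ 1ℚ)}} {{ℚ.≢-nonZero (1≢0 ∘ ∥x∥≡0⇒x≡0 1ℚ)}}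
    ∥1∥*∥1∥≡∥1∥*1 : ∥ 1ℚ ∥ * ∥ 1ℚ ∥ ≡ ∥ 1ℚ ∥ * 1ℚ
    ∥1∥*∥1∥≡∥1∥*1 = trans (sym (∥x*y∥ 1ℚ 1ℚ)) (sym (ℚₚ.*-identityʳ ∥ 1ℚ ∥))

  1≤∥x∥⇒x≢0 : ∀ {x} → 1ℚ ≤ ∥ x ∥ → x ≢ 0ℚ
  1≤∥x∥⇒x≢0 1≤0 refl = <⇒≱ 0<1 (subst (1ℚ ≤_) ∥0∥≡0 1≤0)

  -- Dividing by an element of norm at least 1 does not increase norms. With `q` a denominator, this
  -- carries a bound on q u - p over to p / q - u.
  const-⊗-≼⁻¹ : ∀ {q x c} → 1ℚ ≤ ∥ q ∥ → const q ⊗ x ≼ c → x ≼ c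
  const-⊗-≼⁻¹ {q} {x} {c} 1≤q (N , qx≤c) = N , λ t N≤t → begin
    ∥ term x t ∥            ≡⟨ ℚₚ.*-identityˡ ∥ term x t ∥ ⟨
    1ℚ * ∥ term x t ∥       ≤⟨ ℚₚ.*-monoʳ-≤-nonNeg ∥ term x t ∥
      {{ℚ.nonNegative (0≤∥x∥ (term x t))}} {1ℚ} {∥ q ∥} 1≤q ⟩
    ∥ q ∥ * ∥ term x t ∥    ≡⟨ ∥x*y∥ q (term x t) ⟨
    ∥ q * term x t ∥        ≤⟨ qx≤c t N≤t ⟩
    c                       ∎
    where open ℚₚ.≤-Reasoning

  limit-≼ : ∀ {s u r c K} → 0ℚ < c → (∀ n → K ℕ.≤ n → ∥ s n - r ∥ ≤ c) →
            Tendsto (const ∘ s) u → u ⊖ const r ≼ c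
  -- `Tendsto` bounds a norm through `≤ℝ`, which allows a further positive slack. Taking `½ * c` for
  -- both the bound and the slack gives `c` in total.
  limit-≼ {s} {u} {r} {c} {K} 0<c s-r≤c s→u = near (s→u (½ * c) 0<½c)
    where
    0<½c : 0ℚ < ½ * c
    0<½c = 0<⇒*-pos (ℚₚ.positive⁻¹ ½) 0<c
    near : (∃[ N ] ∀ n → N ℕ.≤ n → norm (const (s n) ⊖ u) ≤ℝ Real.const (½ * c)) → u ⊖ const r ≼ c
    near (N , close) = proj₁ eventually , λ t M≤t → subst (λ d → ∥ d ∥ ≤ c)
      (telescope (term u t) (s n) r)
      (ultrametric-≤ (term u t - s n) (s n - r)
        (subst₂ _≤_ (∥x-y∥≡∥y-x∥ (s n) (term u t)) (halves c) (proj₂ eventually t M≤t))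
        (s-r≤c n (ℕₚ.m≤n⊔m N K)))
      where
      n = N ℕ.⊔ K
      eventually : ∃[ M ] ∀ t → M ℕ.≤ t → ∥ s n - term u t ∥ ≤ ½ * c + ½ * c
      eventually = close n (ℕₚ.m≤m⊔n N K) (½ * c) 0<½c

  tendsto-≼ : ∀ {x : ℕ → Carrier} {u} {d : ℕ → ℚ} → (∀ n → x n ⊖ u ≼ d n) →
              (∀ ε → 0ℚ < ε → ∃[ N ] ∀ n → N ℕ.≤ n → d n ≤ ε) → Tendsto x u
  tendsto-≼ {x} {u} {d} x-u≼d d→0 ε 0<ε = proj₁ (d→0 ε 0<ε) , λ n N≤n ε′ 0<ε′ →
    proj₁ (x-u≼d n) , λ t M≤t → ℚₚ.≤-trans (proj₂ (x-u≼d n) t M≤t)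
      (ℚₚ.≤-trans (proj₂ (d→0 ε 0<ε) n N≤n) (subst (_≤ ε + ε′) (ℚₚ.+-identityʳ ε)
        (ℚₚ.+-monoʳ-≤ ε {0ℚ} {ε′} (ℚₚ.<⇒≤ 0<ε′))))

  -- Continued fractions in an ultrametric completion

  module ContinuedFraction
    (u : Carrier) (β : ℕ → Carrier) (β₀≈u : β 0 ≈ u) (b δ : ℕ → ℚ)
    (0<δ : ∀ n → 0ℚ < δ n) (δ≤1 : ∀ n → δ n ≤ 1ℚ) (δδ<1 : ∀ n → δ (suc n) * δ n < 1ℚ) where

    -- These are predicates on one index rather than hypotheses of the module, so that each result
    -- asks for them only up to the index concerned. A halting run supplies no more than that.
    Reciprocal Close : ℕ → Set
    Reciprocal n = β (suc n) ⊗ (β n ⊖ const (b n)) ≈ const 1ℚ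
    Close n      = β n ⊖ const (b n) ≼ δ n

    -- residual (n + 1) = q_n u - p_n, in product form.
    residual : ℕ → Carrier
    residual zero    = const (- 1ℚ)
    residual (suc n) = (const (b n) ⊖ β n) ⊗ residual n

    bound : ℕ → ℚ
    bound zero    = 1ℚ
    bound (suc n) = δ n * bound n

    0<bound : ∀ n → 0ℚ < bound n
    0<bound zero    = 0<1
    0<bound (suc n) = 0<⇒*-pos (0<δ n) (0<bound n)

    residual-≼ : ∀ n → (∀ m → m ℕ.< n → Close m) → residual n ≼ bound n
    residual-≼ zero    _     = const-≼ (ℚₚ.≤-reflexive (trans (∥-x∥≡∥x∥ 1ℚ) ∥1∥≡1))
    residual-≼ (suc n) close = ⊗-≼ {const (b n) ⊖ β n} {residual n} (ℚₚ.<⇒≤ (0<δ n))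
      (≼-resp-≈ {⊝ (β n ⊖ const (b n))} {const (b n) ⊖ β n} (0<δ n)
        (pointwise {⊝ (β n ⊖ const (b n))} {const (b n) ⊖ β n} (λ t → neg-swap (term (β n) t) (b n)))
        (⊝-≼ {β n ⊖ const (b n)} (close n ℕₚ.≤-refl)))
      (residual-≼ n (λ m m<n → close m (ℕₚ.m<n⇒m<1+n m<n)))

    -- Split the leading factor `b′ - β′`. Its second part contributes `- β′ (b₀ - β₀) r`, which is
    -- `β′ (β₀ - b₀) r`, and this is `r` by reciprocity. The product thus obeys the three-term
    -- recurrence of the convergents.
    residual-recurrence : ∀ n → Reciprocal n →
      residual (suc (suc n)) ≈ const (b (suc n)) ⊗ residual (suc n) ⊕ residual n
    residual-recurrence n recip = begin
      (const b′ ⊖ β′) ⊗ ((const b₀ ⊖ β₀) ⊗ r)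
        ≈⟨ pointwise {(const b′ ⊖ β′) ⊗ ((const b₀ ⊖ β₀) ⊗ r)} {const b′ ⊗ r′ ⊕ β′ ⊗ (β₀ ⊖ const b₀) ⊗ r}
             (λ t → expand b′ (term β′ t) b₀ (term β₀ t) (term r t)) ⟩
      const b′ ⊗ r′ ⊕ β′ ⊗ (β₀ ⊖ const b₀) ⊗ r
        ≈⟨ ⊕-cong {const b′ ⊗ r′} {const b′ ⊗ r′} {β′ ⊗ (β₀ ⊖ const b₀) ⊗ r} {const 1ℚ ⊗ r}
             (≈-refl {const b′ ⊗ r′}) (⊗-congʳ {β′ ⊗ (β₀ ⊖ const b₀)} {const 1ℚ} {r} recip) ⟩
      const b′ ⊗ r′ ⊕ const 1ℚ ⊗ r
        ≈⟨ pointwise {const b′ ⊗ r′ ⊕ const 1ℚ ⊗ r} {const b′ ⊗ r′ ⊕ r}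
             (λ t → cong (_+_ (b′ * term r′ t)) (ℚₚ.*-identityˡ (term r t))) ⟩
      const b′ ⊗ r′ ⊕ r ∎
      where
      open SetoidReasoning ≈-setoid
      b₀ = b n
      b′ = b (suc n)
      β₀ = β n
      β′ = β (suc n)
      r  = residual n
      r′ = residual (suc n)

    linear : ℚ → ℚ → Carrier
    linear x y = const y ⊗ u ⊖ const x

    -- Both sides satisfy the same second-order recurrence, hence the induction on two consecutive
    -- indices, which are the two columns of the matrix. The start is q u - p = -1 for the
    -- conventional p = 1, q = 0 of index -1, and `u - b 0` for index 0.
    residual≈linear : ∀ n → (∀ m → m ℕ.< n → Reciprocal m) →
      let mat pₙ pₙ₋₁ qₙ qₙ₋₁ = convergentMatrix b n in
      residual (suc n) ≈ linear pₙ qₙ × residual n ≈ linear pₙ₋₁ qₙ₋₁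
    residual≈linear zero _ =
      ≈-trans {residual 1} {β 0 ⊖ const (b 0)} {linear (b 0) 1ℚ}
        (pointwise {residual 1} {β 0 ⊖ const (b 0)} (λ t → first (b 0) (term (β 0) t)))
        (≈-trans {β 0 ⊖ const (b 0)} {u ⊖ const (b 0)} {linear (b 0) 1ℚ}
          (⊖-cong {β 0} {u} {const (b 0)} {const (b 0)} β₀≈u (≈-refl {const (b 0)}))
          (pointwise {u ⊖ const (b 0)} {linear (b 0) 1ℚ}
            (λ t → cong (_- b 0) (sym (ℚₚ.*-identityˡ (term u t)))))) ,
      pointwise {residual 0} {linear 1ℚ 0ℚ} (λ t → sym (zeroth (term u t)))
    residual≈linear (suc n) recip = (begin
      residual (suc (suc n))
        ≈⟨ residual-recurrence n (recip n ℕₚ.≤-refl) ⟩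
      const b′ ⊗ residual (suc n) ⊕ residual n
        ≈⟨ ⊕-cong {const b′ ⊗ residual (suc n)} {const b′ ⊗ linear p₀ q₀} {residual n} {linear p₁ q₁}
             (⊗-congˡ {const b′} {residual (suc n)} {linear p₀ q₀} (proj₁ ih)) (proj₂ ih) ⟩
      const b′ ⊗ linear p₀ q₀ ⊕ linear p₁ q₁
        ≈⟨ pointwise {const b′ ⊗ linear p₀ q₀ ⊕ linear p₁ q₁} {linear (p₀ * b′ + p₁ * 1ℚ) (q₀ * b′ + q₁ * 1ℚ)}
             (λ t → collect b′ p₀ p₁ q₀ q₁ (term u t)) ⟩
      linear (p₀ * b′ + p₁ * 1ℚ) (q₀ * b′ + q₁ * 1ℚ) ∎) ,
      (begin
      residual (suc n)
        ≈⟨ proj₁ ih ⟩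
      linear p₀ q₀
        -- The second column of the new matrix is the old first column, as computed by multiplying
        -- with the column (1, 0) of `step b′`.
        ≈⟨ pointwise {linear p₀ q₀} {linear (p₀ * 1ℚ + p₁ * 0ℚ) (q₀ * 1ℚ + q₁ * 0ℚ)}
             (λ t → cong₂ (λ q p → q * term u t - p) (shift q₀ q₁) (shift p₀ p₁)) ⟩
      linear (p₀ * 1ℚ + p₁ * 0ℚ) (q₀ * 1ℚ + q₁ * 0ℚ) ∎)
      where
      open SetoidReasoning ≈-setoid
      ih = residual≈linear n (λ m m<n → recip m (ℕₚ.m<n⇒m<1+n m<n))
      b′ = b (suc n)
      open Mat₂ (convergentMatrix b n) renaming (e₀₀ to p₀; e₀₁ to p₁; e₁₀ to q₀; e₁₁ to q₁)

    -- 1 = b z + ((x - b) z - (x z - 1)), where both terms of the bracket have norm < 1.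
    ∥b∥-large : ∀ {x z b d d′} → ∥ x * z - 1ℚ ∥ < 1ℚ → ∥ z ∥ ≤ d → ∥ x - b ∥ ≤ d′ →
                0ℚ < d → 0ℚ < d′ → d′ * d < 1ℚ → 1ℚ ≤ ∥ b ∥ * d
    ∥b∥-large {x} {z} {b} {d} {d′} xz≈1 z≤d x-b≤d′ 0<d 0<d′ d′d<1 =
      [ (λ 1≤bz → begin
          1ℚ                 ≤⟨ 1≤bz ⟩
          ∥ b * z ∥          ≡⟨ ∥x*y∥ b z ⟩
          ∥ b ∥ * ∥ z ∥      ≤⟨ ℚₚ.*-monoˡ-≤-nonNeg ∥ b ∥ {{ℚ.nonNegative (0≤∥x∥ b)}} {∥ z ∥} {d} z≤d ⟩
          ∥ b ∥ * d          ∎)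
      , (λ 1≤w → ⊥-elim (<⇒≱ small-w 1≤w)) ]′
      (subst (λ y → y ≤ ∥ b * z ∥ ⊎ y ≤ ∥ w ∥) (trans (cong ∥_∥ (split-1 x z b)) ∥1∥≡1) (ultrametric (b * z) w))
      where
      open ℚₚ.≤-Reasoning
      w = (x - b) * z - (x * z - 1ℚ)
      small-w : ∥ w ∥ < 1ℚ
      small-w = ultrametric-< ((x - b) * z) (- (x * z - 1ℚ))
        (begin-strict
          ∥ (x - b) * z ∥       ≡⟨ ∥x*y∥ (x - b) z ⟩
          ∥ x - b ∥ * ∥ z ∥     ≤⟨ *-mono-≤ {∥ x - b ∥} {∥ z ∥} {d′} {d} (0≤∥x∥ z) (ℚₚ.<⇒≤ 0<d′) x-b≤d′ z≤d ⟩
          d′ * d                <⟨ d′d<1 ⟩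
          1ℚ                    ∎)
        (subst (_< 1ℚ) (sym (∥-x∥≡∥x∥ (x * z - 1ℚ))) xz≈1)

    -- The conclusion mentions only the rational `b (suc n)`, so one index `t` at which the three
    -- eventual statements hold together suffices. Accuracy 1 in the reciprocal relation is enough
    -- for `∥b∥-large`.
    partial-quotient-large : ∀ n → Reciprocal n → Close n → Close (suc n) → 1ℚ ≤ ∥ b (suc n) ∥ * δ n
    partial-quotient-large n recip (L , z≤) (M , x≤) = at-large-t (recip 1ℚ 0<1)
      where
      at-large-t : (∃[ N ] ∀ t → N ℕ.≤ t →
                     ∥ term (β (suc n)) t * (term (β n) t - b n) - 1ℚ ∥ < 1ℚ) →
                   1ℚ ≤ ∥ b (suc n) ∥ * δ n
      at-large-t (N , xz≈1) = ∥b∥-large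
        {term (β (suc n)) t} {term (β n) t - b n} {b (suc n)} {δ n} {δ (suc n)}
        (xz≈1 t (ℕₚ.m≤n⊔m (L ℕ.⊔ M) N))
        (z≤ t (ℕₚ.≤-trans (ℕₚ.m≤m⊔n L M) (ℕₚ.m≤m⊔n (L ℕ.⊔ M) N)))
        (x≤ t (ℕₚ.≤-trans (ℕₚ.m≤n⊔m L M) (ℕₚ.m≤m⊔n (L ℕ.⊔ M) N)))
        (0<δ n) (0<δ (suc n)) (δδ<1 n)
        where t = (L ℕ.⊔ M) ℕ.⊔ N

    -- The inductive step for denominators: `q′`, `q` are consecutive ones, `c` is the next partial
    -- quotient, and `d`, `d′` are consecutive values of `δ`. Since `∥ q ∥ ≤ d * ∥ q * c ∥`, the
    -- invariant `d * ∥ q′ ∥ < ∥ q ∥` makes `q * c` dominate `q′`, so that `∥ q ∥ ≤ d * ∥ Q ∥` for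
    -- the new denominator `Q`. Multiplying by `d′` and using `d′ * d < 1ℚ` restores the invariant.
    denominators-grow : ∀ {q q′ c d d′} → 0ℚ < d → d ≤ 1ℚ → 0ℚ < d′ → d′ * d < 1ℚ → 1ℚ ≤ ∥ c ∥ * d →
      1ℚ ≤ ∥ q ∥ → d * ∥ q′ ∥ < ∥ q ∥ →
      1ℚ ≤ ∥ q * c + q′ * 1ℚ ∥ × d′ * ∥ q * 1ℚ + q′ * 0ℚ ∥ < ∥ q * c + q′ * 1ℚ ∥
    denominators-grow {q} {q′} {c} {d} {d′} 0<d d≤1 0<d′ d′d<1 1≤cd 1≤q dq′<q = 1≤Q , (begin-strict
      d′ * ∥ q * 1ℚ + q′ * 0ℚ ∥   ≡⟨ cong (λ y → d′ * ∥ y ∥) (shift q q′) ⟨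
      d′ * ∥ q ∥                  ≤⟨ ℚₚ.*-monoˡ-≤-nonNeg d′ {{ℚ.nonNegative (ℚₚ.<⇒≤ 0<d′)}} {∥ q ∥} {d * ∥ Q ∥} q≤dQ ⟩
      d′ * (d * ∥ Q ∥)            ≡⟨ ℚₚ.*-assoc d′ d ∥ Q ∥ ⟨
      d′ * d * ∥ Q ∥              <⟨ ℚₚ.*-monoˡ-<-pos ∥ Q ∥ {{ℚ.positive (ℚₚ.<-≤-trans 0<1 1≤Q)}} {d′ * d} {1ℚ} d′d<1 ⟩
      1ℚ * ∥ Q ∥                  ≡⟨ ℚₚ.*-identityˡ ∥ Q ∥ ⟩
      ∥ Q ∥                       ∎)
      where
      open ℚₚ.≤-Reasoning
      instance
        d-nonNeg : ℚ.NonNegative d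
        d-nonNeg = ℚ.nonNegative (ℚₚ.<⇒≤ 0<d)
      Q = q * c + q′ * 1ℚ
      q≤d*qc : ∥ q ∥ ≤ d * ∥ q * c ∥
      q≤d*qc = begin
        ∥ q ∥                  ≡⟨ ℚₚ.*-identityʳ ∥ q ∥ ⟨
        ∥ q ∥ * 1ℚ             ≤⟨ ℚₚ.*-monoˡ-≤-nonNeg ∥ q ∥ {{ℚ.nonNegative (0≤∥x∥ q)}} {1ℚ} {∥ c ∥ * d} 1≤cd ⟩
        ∥ q ∥ * (∥ c ∥ * d)    ≡⟨ rotate ∥ q ∥ ∥ c ∥ d ⟩
        d * (∥ q ∥ * ∥ c ∥)    ≡⟨ cong (d *_) (∥x*y∥ q c) ⟨
        d * ∥ q * c ∥          ∎
      q≤dQ : ∥ q ∥ ≤ d * ∥ Q ∥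
      -- The ultrametric inequality is applied to `q * c` written as `Q - q′`; the alternative
      -- `∥ q * c ∥ ≤ ∥ q′ ∥` contradicts the invariant.
      q≤dQ = [ (λ qc≤Q → ℚₚ.≤-trans q≤d*qc (ℚₚ.*-monoˡ-≤-nonNeg d {∥ q * c ∥} {∥ Q ∥} qc≤Q))
             , (λ qc≤q′ → ⊥-elim (<⇒≱ dq′<q (ℚₚ.≤-trans q≤d*qc
                 (ℚₚ.*-monoˡ-≤-nonNeg d {∥ q * c ∥} {∥ q′ ∥} (subst (∥ q * c ∥ ≤_) (∥-x∥≡∥x∥ q′) qc≤q′)))))
             ]′ (subst (λ y → ∥ y ∥ ≤ ∥ Q ∥ ⊎ ∥ y ∥ ≤ ∥ - q′ ∥) (peel (q * c) q′) (ultrametric Q (- q′)))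
      1≤Q : 1ℚ ≤ ∥ Q ∥
      1≤Q = begin
        1ℚ            ≤⟨ 1≤q ⟩
        ∥ q ∥         ≤⟨ q≤dQ ⟩
        d * ∥ Q ∥     ≤⟨ ℚₚ.*-monoʳ-≤-nonNeg ∥ Q ∥ {{ℚ.nonNegative (0≤∥x∥ Q)}} {d} {1ℚ} d≤1 ⟩
        1ℚ * ∥ Q ∥    ≡⟨ ℚₚ.*-identityˡ ∥ Q ∥ ⟩
        ∥ Q ∥         ∎

    -- The weighted comparison with the preceding denominator strengthens the induction. It starts
    -- trivially, because that denominator is 0 for `n` equal to 0.
    denom-large : ∀ n → (∀ m → m ℕ.< n → Reciprocal m) → (∀ m → m ℕ.≤ n → Close m) →
      1ℚ ≤ ∥ denom b n ∥ × δ n * ∥ Mat₂.e₁₁ (convergentMatrix b n) ∥ < ∥ denom b n ∥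
    denom-large zero _ _ = ℚₚ.≤-reflexive (sym ∥1∥≡1) ,
      subst₂ _<_ (sym (trans (cong (δ 0 *_) ∥0∥≡0) (ℚₚ.*-zeroʳ (δ 0)))) (sym ∥1∥≡1) 0<1
    denom-large (suc n) recip close = denominators-grow
      {q₀} {q₁} {b (suc n)} {δ n} {δ (suc n)}
      (0<δ n) (δ≤1 n) (0<δ (suc n)) (δδ<1 n)
      (partial-quotient-large n (recip n ℕₚ.≤-refl) (close n (ℕₚ.n≤1+n n)) (close (suc n) ℕₚ.≤-refl))
      (proj₁ ih) (proj₂ ih)
      where
      ih = denom-large n (λ m m<n → recip m (ℕₚ.m<n⇒m<1+n m<n)) (λ m m≤n → close m (ℕₚ.m≤n⇒m≤1+n m≤n))
      open Mat₂ (convergentMatrix b n) renaming (e₁₀ to q₀; e₁₁ to q₁)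

    denom≢0 : ∀ n → (∀ m → m ℕ.< n → Reciprocal m) → (∀ m → m ℕ.≤ n → Close m) → denom b n ≢ 0ℚ
    denom≢0 n recip close = 1≤∥x∥⇒x≢0 (proj₁ (denom-large n recip close))

    -- Multiplied by `q`, the difference becomes the negative of `linear (numer b n) q`, that is, of
    -- `residual (suc n)`, whose bound is known. As `q` has norm at least 1, it can be divided out.
    convergent-≼ : ∀ n → (∀ m → m ℕ.< n → Reciprocal m) → (∀ m → m ℕ.≤ n → Close m) →
      (q≢0 : denom b n ≢ 0ℚ) → const (convergent b n q≢0) ⊖ u ≼ bound (suc n)
    convergent-≼ n recip close q≢0 = const-⊗-≼⁻¹ {q} {const c ⊖ u} (proj₁ (denom-large n recip close))
      (≼-resp-≈ {⊝ linear (numer b n) q} {const q ⊗ (const c ⊖ u)} (0<bound (suc n))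
        (pointwise {⊝ linear (numer b n) q} {const q ⊗ (const c ⊖ u)} (λ t →
          trans (cong (λ y → - (q * term u t - y)) (sym (x*[y÷x] q (numer b n) q≢0)))
                (unlinear q c (term u t))))
        (⊝-≼ {linear (numer b n) q} (≼-resp-≈ {residual (suc n)} {linear (numer b n) q} (0<bound (suc n))
          (proj₁ (residual≈linear n recip))
          (residual-≼ (suc n) (λ m m<1+n → close m (ℕₚ.m<1+n⇒m≤n m<1+n))))))
      where
      q = denom b n
      c = convergent b n q≢0

    convergent≈ : ∀ n → (∀ m → m ℕ.< n → Reciprocal m) → β n ≈ const (b n) →
      (q≢0 : denom b n ≢ 0ℚ) → const (convergent b n q≢0) ≈ u
    convergent≈ n recip βₙ≈bₙ q≢0 = const-⊗-cancel {q} {const c} {u} q≢0 (begin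
      const q ⊗ const c
        -- A zero multiple of `residual n` is inserted: replacing its factor 0 by `b n - β n` turns
        -- it into `residual (suc n)`.
        ≈⟨ pointwise {const q ⊗ const c} {const 0ℚ ⊗ residual n ⊕ const x}
             (λ t → trans (x*[y÷x] q x q≢0) (sym (vanish (term (residual n) t) x))) ⟩
      const 0ℚ ⊗ residual n ⊕ const x
        ≈⟨ ⊕-cong {const 0ℚ ⊗ residual n} {residual (suc n)} {const x} {const x}
             (⊗-congʳ {const 0ℚ} {const (b n) ⊖ β n} {residual n} 0≈) (≈-refl {const x}) ⟩
      residual (suc n) ⊕ const x
        ≈⟨ ⊕-cong {residual (suc n)} {linear x q} {const x} {const x}
             (proj₁ (residual≈linear n recip)) (≈-refl {const x}) ⟩
      linear x q ⊕ const x
        ≈⟨ pointwise {linear x q ⊕ const x} {const q ⊗ u} (λ t → [x-y]+y≡x (q * term u t) x) ⟩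
      const q ⊗ u ∎)
      where
      open SetoidReasoning ≈-setoid
      q = denom b n
      x = numer b n
      c = convergent b n q≢0
      0≈ : const 0ℚ ≈ const (b n) ⊖ β n
      0≈ = begin
        const 0ℚ                     ≈⟨ pointwise {const 0ℚ} {const (b n) ⊖ const (b n)}
                                          (λ _ → sym (ℚₚ.+-inverseʳ (b n))) ⟩
        const (b n) ⊖ const (b n)    ≈⟨ ⊖-cong {const (b n)} {const (b n)} {const (b n)} {β n}
                                          (≈-refl {const (b n)}) (≈-sym {β n} {const (b n)} βₙ≈bₙ) ⟩
        const (b n) ⊖ β n            ∎

-- Explicit p-adic absolute values

module PadicNorm (p : ℕ) (pr : Prime p) where
  open Valuation p pr public

  fracNorm≡p^ : ∀ a b .{{_ : ℕ.NonZero a}} → fracNorm a b ≡ p^[ v b - v a ]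
  fracNorm≡p^ (suc _) b = refl

  -- `∣_∣ₚ` reads off the reduced numerator and denominator, and forming `i / n` may cancel common
  -- factors. By `fracNorm-cong` the value of `fracNorm` is unaffected by this.
  ∣i/n∣ₚ : ∀ i n .{{_ : ℕ.NonZero n}} → ∣ i / n ∣ₚ ≡ fracNorm ℤ.∣ i ∣ n
  ∣i/n∣ₚ i (suc n-1) = from-≃ (i / suc n-1) (ℚₚ.toℚᵘ-fromℚᵘ (mkℚᵘ i n-1))
    where
    from-≃ : ∀ x → toℚᵘ x ℚᵘ.≃ mkℚᵘ i n-1 → ∣ x ∣ₚ ≡ fracNorm ℤ.∣ i ∣ (suc n-1)
    from-≃ x@(mkℚ j d-1 _) (*≡* e) = fracNorm-cong ℤ.∣ j ∣ (suc d-1) ℤ.∣ i ∣ (suc n-1)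
      (trans (sym (ℤₚ.abs-* j (+ suc n-1))) (trans (cong ℤ.∣_∣ e) (ℤₚ.abs-* i (+ suc d-1))))

  fracNorm[1,1]≡1 : fracNorm 1 1 ≡ 1ℚ
  fracNorm[1,1]≡1 = p^-cong (v 1) (v 1) 0 0 (ℕₚ.+-identityʳ (v 1))

  fracNorm[n,1]≤1 : ∀ n → fracNorm n 1 ≤ 1ℚ
  fracNorm[n,1]≤1 n = subst (fracNorm n 1 ≤_) fracNorm[1,1]≡1
    (fracNorm-anti n 1 1 (ℕ∣.∣-trans (v-∣ 1) (ℕ∣.1∣ n)))

  ∣i/1∣ₚ≤1 : ∀ i → ∣ i / 1 ∣ₚ ≤ 1ℚ
  ∣i/1∣ₚ≤1 i = subst (_≤ 1ℚ) (sym (∣i/n∣ₚ i 1)) (fracNorm[n,1]≤1 ℤ.∣ i ∣)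

  fracNorm-*-≤ : ∀ m n → fracNorm (m ℕ.* n) 1 ≤ fracNorm n 1
  fracNorm-*-≤ m n = begin
    fracNorm (m ℕ.* n) 1           ≡⟨ fracNorm-* m 1 n 1 ⟩
    fracNorm m 1 * fracNorm n 1    ≤⟨ ℚₚ.*-monoʳ-≤-nonNeg (fracNorm n 1)
      {{ℚ.nonNegative (fracNorm-nonneg n 1)}} (fracNorm[n,1]≤1 m) ⟩
    1ℚ * fracNorm n 1              ≡⟨ ℚₚ.*-identityˡ (fracNorm n 1) ⟩
    fracNorm n 1                   ∎
    where open ℚₚ.≤-Reasoning

  ∣ij/1∣ₚ≤∣j/1∣ₚ : ∀ i j → ∣ (i ℤ.* j) / 1 ∣ₚ ≤ ∣ j / 1 ∣ₚ
  ∣ij/1∣ₚ≤∣j/1∣ₚ i j = begin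
    ∣ (i ℤ.* j) / 1 ∣ₚ                    ≡⟨ ∣i/n∣ₚ (i ℤ.* j) 1 ⟩
    fracNorm ℤ.∣ i ℤ.* j ∣ 1              ≡⟨ cong (λ k → fracNorm k 1) (ℤₚ.abs-* i j) ⟩
    fracNorm (ℤ.∣ i ∣ ℕ.* ℤ.∣ j ∣) 1      ≤⟨ fracNorm-*-≤ ℤ.∣ i ∣ ℤ.∣ j ∣ ⟩
    fracNorm ℤ.∣ j ∣ 1                    ≡⟨ ∣i/n∣ₚ j 1 ⟨
    ∣ j / 1 ∣ₚ                            ∎
    where open ℚₚ.≤-Reasoning

  ∣p∣ₚ : ℚ
  ∣p∣ₚ = fracNorm p 1

  -- `v 1` does not compute for a variable `p`; additivity on the product 1 · 1 determines it
  -- instead.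
  v[1]≡0 : v 1 ≡ 0
  v[1]≡0 = ℕₚ.+-cancelˡ-≡ (v 1) (v 1) 0 (trans (sym (v-* 1 1)) (sym (ℕₚ.+-identityʳ (v 1))))

  ∣p∣ₚ≤p⁻¹ : ∣p∣ₚ ≤ p^[ 0 - 1 ]
  ∣p∣ₚ≤p⁻¹ = begin
    fracNorm p 1        ≡⟨ fracNorm≡p^ p 1 ⟩
    p^[ v 1 - v p ]     ≡⟨ cong p^[_- v p ] v[1]≡0 ⟩
    p^[ 0 - v p ]       ≤⟨ p^-anti 0 (v-max p 1 (ℕ∣.∣-reflexive (ℕₚ.^-identityʳ p))) ⟩
    p^[ 0 - 1 ]         ∎
    where open ℚₚ.≤-Reasoning

  p^-small : ∀ {ε} k → 0ℚ < ε → ↧ₙ ε ℕ.< p ^ k → p^[ 0 - k ] < ε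
  p^-small k = 1/n<ε (p ^ k) {{p^k≢0 k}}

  ∣p∣ₚ<1 : ∣p∣ₚ < 1ℚ
  ∣p∣ₚ<1 = ℚₚ.≤-<-trans ∣p∣ₚ≤p⁻¹ (p^-small 1 0<1 (subst (1 ℕ.<_) (sym (ℕₚ.^-identityʳ p)) 1<p))

  0<∣p∣ₚ : 0ℚ < ∣p∣ₚ
  0<∣p∣ₚ = ℚₚ.positive⁻¹ ∣p∣ₚ {{ℚₚ.nonNeg∧nonZero⇒pos ∣p∣ₚ
    {{ℚ.nonNegative (fracNorm-nonneg p 1)}} {{ℚ.≢-nonZero ∣p∣ₚ≢0}}}}
    where
    ∣p∣ₚ≢0 : ∣p∣ₚ ≢ 0ℚ
    ∣p∣ₚ≢0 = p^≢0 (v 1) (v p) ∘ trans (sym (fracNorm≡p^ p 1))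

  -- Cross-multiplication replaces the fraction by the integer p^(n - k - 1) · p, a multiple of `p`.
  ∣p^∣ₚ≤∣p∣ₚ : ∀ {n k} → k ℕ.< n → ∣ p^[ n - k ] ∣ₚ ≤ ∣p∣ₚ
  ∣p^∣ₚ≤∣p∣ₚ {n} {k} k<n = begin
    ∣ p^[ n - k ] ∣ₚ                         ≡⟨ ∣i/n∣ₚ (+ (p ^ n)) (p ^ k) {{p^k≢0 k}} ⟩
    fracNorm (p ^ n) (p ^ k)                 ≡⟨ fracNorm-cong (p ^ n) (p ^ k) (p ^ j ℕ.* p) 1 {{p^k≢0 k}} e ⟩
    fracNorm (p ^ j ℕ.* p) 1                 ≤⟨ fracNorm-*-≤ (p ^ j) p ⟩
    ∣p∣ₚ                                     ∎
    where
    j = n ℕ.∸ suc k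
    e : p ^ n ℕ.* 1 ≡ p ^ j ℕ.* p ℕ.* p ^ k
    e = trans (ℕₚ.*-identityʳ (p ^ n)) (trans (cong (p ^_) (sym (ℕₚ.m∸n+n≡m k<n)))
      (trans (ℕₚ.^-distribˡ-+-* p j (suc k)) (sym (ℕₚ.*-assoc (p ^ j) p (p ^ k)))))
    open ℚₚ.≤-Reasoning


-- Floors, partial quotients and the embedding into the p-adic numbers

module PadicAlgorithm
  {a ℓ₁ ℓ₂ : Level} (p : ℕ) (pr : Prime p) (K : HeytingField a ℓ₁ ℓ₂)
  (σ∞ : Embedding K Real.rawRing) (σₚ : Embedding K (Padic.ℚₚ-rawRing p pr)) where
  open PadicNorm p pr
  open Padic p pr using (ℚₚ; term; _≈_; const; _⊕_; _⊗_; _⊖_; ⊝_; partialSum; DigitExpansion; IsFloor)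
  open UltrametricCompletion padic ultrametric
  open Algorithm p pr K σ∞ σₚ
  private
    module K = HeytingField K
  open RingMorphisms.IsRingMonomorphism (Embedding.isRingMonomorphism σₚ)

  -- The floor stops after index `k`, whose exponent is 0. Every later index `m` has exponent m - k
  -- at least 1, so its term is a p-adic integer multiple of `p`, and the ultrametric inequality
  -- bounds the whole sum.
  partialSum-tail : ∀ k c j → ∣ partialSum k c (j ℕ.+ suc k) - partialSum k c (suc k) ∣ₚ ≤ ∣p∣ₚ
  partialSum-tail k c zero    = subst (λ x → ∣ x ∣ₚ ≤ ∣p∣ₚ)
    (sym (ℚₚ.+-inverseʳ (partialSum k c (suc k)))) (ℚₚ.<⇒≤ 0<∣p∣ₚ)
  partialSum-tail k c (suc j) = subst (λ x → ∣ x ∣ₚ ≤ ∣p∣ₚ)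
    (append (partialSum k c m) (digit * p^[ m - k ]) (partialSum k c (suc k)))
    (ultrametric-≤ (partialSum k c m - partialSum k c (suc k)) (digit * p^[ m - k ])
      (partialSum-tail k c j) term≤)
    where
    m = j ℕ.+ suc k
    digit = + toℕ (c m) / 1
    open ℚₚ.≤-Reasoning
    term≤ : ∣ digit * p^[ m - k ] ∣ₚ ≤ ∣p∣ₚ
    term≤ = begin
      ∣ digit * p^[ m - k ] ∣ₚ           ≡⟨ ∣x*y∣ₚ digit p^[ m - k ] ⟩
      ∣ digit ∣ₚ * ∣ p^[ m - k ] ∣ₚ      ≤⟨ *-mono-≤ {∣ digit ∣ₚ} {∣ p^[ m - k ] ∣ₚ} {1ℚ} {∣p∣ₚ}
        (0≤∣x∣ₚ p^[ m - k ]) (ℚₚ.<⇒≤ 0<1) (∣i/1∣ₚ≤1 (+ toℕ (c m))) (∣p^∣ₚ≤∣p∣ₚ (ℕₚ.m≤n+m (suc k) j)) ⟩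
      1ℚ * ∣p∣ₚ                          ≡⟨ ℚₚ.*-identityˡ ∣p∣ₚ ⟩
      ∣p∣ₚ                               ∎

  floor-≼ : ∀ {u r} → IsFloor u r → u ⊖ const r ≼ ∣p∣ₚ
  floor-≼ {u} (e , refl) = limit-≼ {partialSum k c} {u} {partialSum k c (suc k)} {∣p∣ₚ} {suc k} 0<∣p∣ₚ
    (λ n k<n → subst (λ m → ∣ partialSum k c m - partialSum k c (suc k) ∣ₚ ≤ ∣p∣ₚ)
      (ℕₚ.m∸n+n≡m k<n) (partialSum-tail k c (n ℕ.∸ suc k)))
    sum
    where open DigitExpansion e

  gap : Fin 2 → ℚ
  gap zero    = ∣p∣ₚ
  gap (suc _) = 1ℚ

  0<gap : ∀ ε → 0ℚ < gap ε
  0<gap zero    = 0<∣p∣ₚ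
  0<gap (suc _) = 0<1

  ∣p∣ₚ≤gap : ∀ ε → ∣p∣ₚ ≤ gap ε
  ∣p∣ₚ≤gap zero    = ℚₚ.≤-refl
  ∣p∣ₚ≤gap (suc _) = ℚₚ.<⇒≤ ∣p∣ₚ<1

  gap≤1 : ∀ ε → gap ε ≤ 1ℚ
  gap≤1 zero    = ℚₚ.<⇒≤ ∣p∣ₚ<1
  gap≤1 (suc _) = ℚₚ.≤-refl

  ∣spacing∣ₚ≡gap : ∀ ε → ∣ + spacing ε / 1 ∣ₚ ≡ gap ε
  ∣spacing∣ₚ≡gap zero    = ∣i/n∣ₚ (+ p) 1
  ∣spacing∣ₚ≡gap (suc _) = ∥1∥≡1

  δ : ℕ → ℚ
  δ n = gap (n mod 2)

  δδ≡∣p∣ₚ : ∀ n → δ (suc n) * δ n ≡ ∣p∣ₚ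
  δδ≡∣p∣ₚ zero          = ℚₚ.*-identityˡ ∣p∣ₚ
  δδ≡∣p∣ₚ (suc zero)    = ℚₚ.*-identityʳ ∣p∣ₚ
  -- `suc (suc n) mod 2` reduces to `n mod 2`, so the two statements coincide by computation.
  δδ≡∣p∣ₚ (suc (suc n)) = δδ≡∣p∣ₚ n

  -- Write α - b as (α - r) - m s with s the spacing. The floor controls the first part by `∣p∣ₚ`,
  -- and the second is an integer multiple of s, whose norm is exactly `gap ε`.
  partialQuotient-≼ : ∀ {ε α b} → IsPartialQuotient ε α b → ⟦ α ⟧ₚ ⊖ const b ≼ gap ε
  partialQuotient-≼ {ε} {α} (r , m , floor , _ , refl) =
    ≼-resp-≈ {⟦ α ⟧ₚ ⊖ const r ⊕ const (- ms)} {⟦ α ⟧ₚ ⊖ const (ms + r)} (0<gap ε)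
      (pointwise {⟦ α ⟧ₚ ⊖ const r ⊕ const (- ms)} {⟦ α ⟧ₚ ⊖ const (ms + r)}
        (λ t → subtract-sum (term ⟦ α ⟧ₚ t) ms r))
      (⊕-≼ {⟦ α ⟧ₚ ⊖ const r} {const (- ms)}
        (≼-trans {⟦ α ⟧ₚ ⊖ const r} (floor-≼ {⟦ α ⟧ₚ} {r} floor) (∣p∣ₚ≤gap ε))
        (const-≼ { - ms} ∣ms∣≤gap))
    where
    ms = (m ℤ.* + spacing ε) / 1
    open ℚₚ.≤-Reasoning
    ∣ms∣≤gap : ∣ - ms ∣ₚ ≤ gap ε
    ∣ms∣≤gap = begin
      ∣ - ms ∣ₚ                 ≡⟨ ∣-x∣ₚ≡∣x∣ₚ ms ⟩
      ∣ ms ∣ₚ                   ≤⟨ ∣ij/1∣ₚ≤∣j/1∣ₚ m (+ spacing ε) ⟩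
      ∣ + spacing ε / 1 ∣ₚ      ≡⟨ ∣spacing∣ₚ≡gap ε ⟩
      gap ε                     ∎

  ⟦fromℕ⟧ : ∀ n → ⟦ fromℤ (+ n) ⟧ₚ ≈ const (+ n / 1)
  ⟦fromℕ⟧ zero    = 0#-homo
  ⟦fromℕ⟧ (suc n) = begin
    ⟦ K.1# K.+ fromℤ (+ n) ⟧ₚ          ≈⟨ +-homo K.1# (fromℤ (+ n)) ⟩
    ⟦ K.1# ⟧ₚ ⊕ ⟦ fromℤ (+ n) ⟧ₚ       ≈⟨ ⊕-cong {⟦ K.1# ⟧ₚ} {const 1ℚ} {⟦ fromℤ (+ n) ⟧ₚ} {const (+ n / 1)}
                                            1#-homo (⟦fromℕ⟧ n) ⟩
    const 1ℚ ⊕ const (+ n / 1)         ≈⟨ pointwise {const 1ℚ ⊕ const (+ n / 1)} {const (+ suc n / 1)}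
                                            (λ _ → +-/1 (+ 1) (+ n)) ⟩
    const (+ suc n / 1)                ∎
    where open SetoidReasoning ≈-setoid

  ⟦fromℤ⟧ : ∀ i → ⟦ fromℤ i ⟧ₚ ≈ const (i / 1)
  ⟦fromℤ⟧ (+ n)    = ⟦fromℕ⟧ n
  ⟦fromℤ⟧ -[1+ n ] = ≈-trans {⟦ fromℤ -[1+ n ] ⟧ₚ} {⊝ ⟦ fromℤ (+ suc n) ⟧ₚ} {const (-[1+ n ] / 1)}
    (-‿homo (fromℤ (+ suc n))) (⊝-cong {⟦ fromℤ (+ suc n) ⟧ₚ} {const (+ suc n / 1)} (⟦fromℕ⟧ (suc n)))

  -- Apply the embedding to the defining equation, denominator times `x` equals numerator, and
  -- cancel the denominator, a nonzero rational.
  represents⇒≈ : ∀ {x r} → x represents r → ⟦ x ⟧ₚ ≈ const r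
  represents⇒≈ {x} {r} x-rep-r = const-⊗-cancel {↧ r / 1} {⟦ x ⟧ₚ} {const r} ↧r≢0 (begin
    const (↧ r / 1) ⊗ ⟦ x ⟧ₚ        ≈⟨ ⊗-congʳ {⟦ fromℤ (↧ r) ⟧ₚ} {const (↧ r / 1)} {⟦ x ⟧ₚ} (⟦fromℤ⟧ (↧ r)) ⟨
    ⟦ fromℤ (↧ r) ⟧ₚ ⊗ ⟦ x ⟧ₚ       ≈⟨ *-homo (fromℤ (↧ r)) x ⟨
    ⟦ fromℤ (↧ r) K.* x ⟧ₚ          ≈⟨ ⟦⟧-cong x-rep-r ⟩
    ⟦ fromℤ (↥ r) ⟧ₚ                ≈⟨ ⟦fromℤ⟧ (↥ r) ⟩
    const (↥ r / 1)                 ≈⟨ pointwise {const (↥ r / 1)} {const (↧ r / 1) ⊗ const r}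
                                         (λ _ → sym (↧/1*r r)) ⟩
    const (↧ r / 1) ⊗ const r       ∎)
    where
    open SetoidReasoning ≈-setoid
    ↧r≢0 : ↧ r / 1 ≢ 0ℚ
    ↧r≢0 e = ℚₚ.<⇒≢ (ℚₚ.positive⁻¹ (↧ r / 1) {{ℚₚ.normalize-pos (↧ₙ r) 1}}) (sym e)

  reciprocal-⟦⟧ : ∀ {α b β} → IsReciprocal α b β → ⟦ β ⟧ₚ ⊗ (⟦ α ⟧ₚ ⊖ const b) ≈ const 1ℚ
  reciprocal-⟦⟧ {α} {b} {β} (x , x-rep-b , β[α-x]≈1) = begin
    ⟦ β ⟧ₚ ⊗ (⟦ α ⟧ₚ ⊖ const b)       ≈⟨ ⊗-congˡ {⟦ β ⟧ₚ} {⟦ α ⟧ₚ ⊖ const b} {⟦ α ⟧ₚ ⊖ ⟦ x ⟧ₚ}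
      (⊖-cong {⟦ α ⟧ₚ} {⟦ α ⟧ₚ} {const b} {⟦ x ⟧ₚ} (≈-refl {⟦ α ⟧ₚ})
        (≈-sym {⟦ x ⟧ₚ} {const b} (represents⇒≈ x-rep-b))) ⟩
    ⟦ β ⟧ₚ ⊗ (⟦ α ⟧ₚ ⊖ ⟦ x ⟧ₚ)        ≈⟨ ⊗-congˡ {⟦ β ⟧ₚ} {⟦ α ⟧ₚ ⊖ ⟦ x ⟧ₚ} {⟦ α ⟧ₚ ⊕ ⟦ K.- x ⟧ₚ}
      (⊕-cong {⟦ α ⟧ₚ} {⟦ α ⟧ₚ} {⊝ ⟦ x ⟧ₚ} {⟦ K.- x ⟧ₚ} (≈-refl {⟦ α ⟧ₚ})
        (≈-sym {⟦ K.- x ⟧ₚ} {⊝ ⟦ x ⟧ₚ} (-‿homo x))) ⟩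
    ⟦ β ⟧ₚ ⊗ (⟦ α ⟧ₚ ⊕ ⟦ K.- x ⟧ₚ)    ≈⟨ ⊗-congˡ {⟦ β ⟧ₚ} {⟦ α K.- x ⟧ₚ} {⟦ α ⟧ₚ ⊕ ⟦ K.- x ⟧ₚ}
      (+-homo α (K.- x)) ⟨
    ⟦ β ⟧ₚ ⊗ ⟦ α K.- x ⟧ₚ             ≈⟨ *-homo β (α K.- x) ⟨
    ⟦ β K.* (α K.- x) ⟧ₚ              ≈⟨ ⟦⟧-cong β[α-x]≈1 ⟩
    ⟦ K.1# ⟧ₚ                         ≈⟨ 1#-homo ⟩
    const 1ℚ                          ∎
    where open SetoidReasoning ≈-setoid

  -- Convergence of the convergents

  module Expansion (α : K.Carrier) (αs : ℕ → K.Carrier) (bs : ℕ → ℚ) (α₀≈α : αs 0 K.≈ α) where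
    open ContinuedFraction ⟦ α ⟧ₚ (λ n → ⟦ αs n ⟧ₚ) (⟦⟧-cong α₀≈α) bs δ
      (λ n → 0<gap (n mod 2)) (λ n → gap≤1 (n mod 2))
      (λ n → subst (_< 1ℚ) (sym (δδ≡∣p∣ₚ n)) ∣p∣ₚ<1) public

    -- Two consecutive factors `δ` multiply to `∣p∣ₚ`, which is at most 1 / p. For odd `n` one
    -- factor is left over, and it is at most 1.
    bound≤p^ : ∀ n → bound n ≤ p^[ 0 - ⌊ n /2⌋ ]
    bound≤p^ zero          = ℚₚ.≤-refl
    bound≤p^ (suc zero)    = subst (_≤ 1ℚ) (sym (ℚₚ.*-identityʳ (δ 0))) (gap≤1 zero)
    bound≤p^ (suc (suc n)) = begin
      δ (suc n) * (δ n * bound n)            ≡⟨ ℚₚ.*-assoc (δ (suc n)) (δ n) (bound n) ⟨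
      δ (suc n) * δ n * bound n              ≡⟨ cong (_* bound n) (δδ≡∣p∣ₚ n) ⟩
      ∣p∣ₚ * bound n                         ≤⟨ *-mono-≤ {∣p∣ₚ} {bound n} {p^[ 0 - 1 ]} {p^[ 0 - ⌊ n /2⌋ ]}
        (ℚₚ.<⇒≤ (0<bound n)) (0≤p^ 0 1) ∣p∣ₚ≤p⁻¹ (bound≤p^ n) ⟩
      p^[ 0 - 1 ] * p^[ 0 - ⌊ n /2⌋ ]        ≡⟨ p^-* 0 1 0 ⌊ n /2⌋ ⟨
      p^[ 0 - suc ⌊ n /2⌋ ]                  ∎
      where open ℚₚ.≤-Reasoning

    bound→0 : ∀ ε → 0ℚ < ε → ∃[ N ] ∀ n → N ℕ.≤ n → bound (suc n) ≤ ε
    -- For n at least 2d, the exponent k = `⌊ suc n /2⌋` is at least the denominator `d` of `ε`.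
    -- Then p^k > k gives p^k > d, hence 1 / p^k < `ε`.
    bound→0 ε 0<ε = d ℕ.+ d , λ n 2d≤n → ℚₚ.≤-trans (bound≤p^ (suc n))
      (ℚₚ.<⇒≤ (p^-small ⌊ suc n /2⌋ 0<ε (ℕₚ.≤-<-trans
        (subst (ℕ._≤ ⌊ suc n /2⌋) (sym (ℕₚ.n≡⌊n+n/2⌋ d)) (ℕₚ.⌊n/2⌋-mono (ℕₚ.m≤n⇒m≤1+n 2d≤n)))
        (k<p^k ⌊ suc n /2⌋))))
      where d = ↧ₙ ε

    convergentsTendTo-forever : (adv : ∀ n → Advances αs bs n) →
      ConvergentsTendTo (forever αs bs α₀≈α adv) ⟦ α ⟧ₚ
    convergentsTendTo-forever adv = q≢0 ,
      tendsto-≼ {λ n → const (convergent bs n (q≢0 n))} {⟦ α ⟧ₚ} {λ n → bound (suc n)}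
        (λ n → convergent-≼ n (λ m _ → recip m) (λ m _ → close m) (q≢0 n)) bound→0
      where
      recip : ∀ n → Reciprocal n
      recip n = reciprocal-⟦⟧ (proj₂ (adv n))
      close : ∀ n → Close n
      close n = partialQuotient-≼ (proj₁ (adv n))
      q≢0 : ∀ n → denom bs n ≢ 0ℚ
      q≢0 n = denom≢0 n (λ m _ → recip m) (λ m _ → close m)

    convergentsTendTo-halting : ∀ N (adv : ∀ n → n ℕ.< N → Advances αs bs n) (halt : Halts αs bs N) →
      ConvergentsTendTo (halting N αs bs α₀≈α adv halt) ⟦ α ⟧ₚ
    convergentsTendTo-halting N adv (quotient , α-rep-b) = q≢0 ,
      convergent≈ N (λ m → recip) (represents⇒≈ α-rep-b) (q≢0 N ℕₚ.≤-refl)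
      where
      recip : ∀ {n} → n ℕ.< N → Reciprocal n
      recip {n} n<N = reciprocal-⟦⟧ (proj₂ (adv n n<N))
      close : ∀ {n} → n ℕ.≤ N → Close n
      -- Stage `N` does not advance, so its partial quotient comes from the halting condition
      -- instead.
      close {n} n≤N = [ (λ n<N → partialQuotient-≼ (proj₁ (adv n n<N)))
                      , (λ { refl → partialQuotient-≼ quotient }) ]′ (ℕₚ.m≤n⇒m<n∨m≡n n≤N)
      q≢0 : ∀ n → n ℕ.≤ N → denom bs n ≢ 0ℚ
      q≢0 n n≤N = denom≢0 n (λ m m<n → recip (ℕₚ.<-≤-trans m<n n≤N)) (λ m m≤n → close (ℕₚ.≤-trans m≤n n≤N))

corollary2p13 : {a ℓ₁ ℓ₂ : Level} (p : ℕ) (pr : Prime p) (K : HeytingField a ℓ₁ ℓ₂)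
    (σ∞ : Embedding K Real.rawRing) (σₚ : Embedding K (Padic.ℚₚ-rawRing p pr))
    (α : HeytingField.Carrier K) (run : Algorithm.Run p pr K σ∞ σₚ α) →
    Algorithm.ConvergentsTendTo p pr K σ∞ σₚ run (Embedding.⟦_⟧ σₚ α)
corollary2p13 p pr K σ∞ σₚ α (Algorithm.forever αs bs α₀≈α adv) =
  convergentsTendTo-forever adv
  where open PadicAlgorithm.Expansion p pr K σ∞ σₚ α αs bs α₀≈α
corollary2p13 p pr K σ∞ σₚ α (Algorithm.halting N αs bs α₀≈α adv halt) =
  convergentsTendTo-halting N adv halt
  where open PadicAlgorithm.Expansion p pr K σ∞ σₚ α αs bs α₀≈α
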